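{- We have $$A^{2143}(x,q)=1+I^{2143}(x,q)+x\left(A^{2143}(x,q)-1\right)+\frac{x}{1-x}\left(I^{2143}(x,q)-x\right).$$ Moreover, $$I^{2143}(x)=(1-x)^2E(x)+2x-1,$$ $I^{2143}_1=1$, and for $n\ge2$, $I^{2143}_n=E_n-2E_{n-1}+E_{n-2}$, where $E_m$ is the number of $1234$-avoiding permutations of $[m]$ ($E_0=1$) and $E(x)=\sum_{m\ge0}E_mx^m$.
   Context: For a permutation $\pi=\pi_1\cdots\pi_n$ of $[n]$, let $i_\pi$ be the smallest index $i$ with $\{\pi_1,\dots,\pi_i\}=\{1,\dots,i\}$; $\pi$ is indecomposable if $i_\pi=n$ (the empty permutation is not indecomposable). A permutation $\pi$ avoids a pattern $\tau\in\mathfrak S_k$ if no subsequence $\pi_{j_1}\cdots\pi_{j_k}$ ($j_1<\cdots<j_k$) is order-isomorphic to $\tau$. A descent of $\pi$ is an index $i$ with $\pi_i>\pi_{i+1}$. For a pattern $\sigma$, $A^\sigma_{n,i}$ (resp. $I^\sigma_{n,i}$) is the number of $\sigma$-avoiding permutations (resp. $\sigma$-avoiding indecomposable permutations) of $[n]$ with $i$ descents; $A^\sigma(x,q)=1+\sum_{n\ge1}\sum_iA^\sigma_{n,i}x^nq^i$, $I^\sigma(x,q)=\sum_{n\ge1}\sum_iI^\sigma_{n,i}x^nq^i$, $I^\sigma(x)=I^\sigma(x,1)=\sum_{n\ge1}I^\sigma_nx^n$. It is known that $1234$ and $2143$ are Wilf-equivalent, i.e. $E_m$ also equals the number of $2143$-avoiding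 permutations of $[m]$. -}

module Defs where

open import Data.Bool using (Bool; true; false; _∧_; _∨_; not; if_then_else_)
open import Data.Nat using (ℕ; zero; suc; _+_; _≡ᵇ_; _<ᵇ_; _≤ᵇ_)
open import Data.List using (List; []; _∷_; length; map; concatMap; take; filterᵇ; applyUpTo)
open import Data.Bool.ListAction using (all; any)
open import Data.Integer using (ℤ; +_; _-_)
import Data.Integer as ℤ

range1 : ℕ → List ℕ
range1 n = applyUpTo suc n

words : ℕ → List ℕ → List (List ℕ)
words zero    xs = [] ∷ []
words (suc k) xs = concatMap (λ a → map (a ∷_) (words k xs)) xs

memᵇ : ℕ → List ℕ → Bool
memᵇ x ys = any (λ y → x ≡ᵇ y) ys

distinctᵇ : List ℕ → Bool
distinctᵇ []       = true
distinctᵇ (x ∷ xs) = not (memᵇ x xs) ∧ distinctᵇ xs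

perms : ℕ → List (List ℕ)
perms n = filterᵇ distinctᵇ (words n (range1 n))

subseqs : List ℕ → List (List ℕ)
subseqs []       = [] ∷ []
subseqs (x ∷ xs) = map (x ∷_) (subseqs xs) ++' subseqs xs
  where
  _++'_ : List (List ℕ) → List (List ℕ) → List (List ℕ)
  []       ++' ys = ys
  (z ∷ zs) ++' ys = z ∷ (zs ++' ys)

sameOrder : ℕ → ℕ → ℕ → ℕ → Bool
sameOrder x y a b = ((x <ᵇ y) ≡ᵇᵇ (a <ᵇ b)) ∧ ((x ≡ᵇ y) ≡ᵇᵇ (a ≡ᵇ b))
  where
  _≡ᵇᵇ_ : Bool → Bool → Bool
  true  ≡ᵇᵇ c = c
  false ≡ᵇᵇ c = not c

headCompat : ℕ → List ℕ → ℕ → List ℕ → Bool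
headCompat x []       a []       = true
headCompat x (y ∷ ys) a (b ∷ bs) = sameOrder x y a b ∧ headCompat x ys a bs
headCompat x _        a _        = false

orderIso : List ℕ → List ℕ → Bool
orderIso []       []       = true
orderIso (x ∷ xs) (a ∷ as) = headCompat x xs a as ∧ orderIso xs as
orderIso _        _        = false

containsᵇ : List ℕ → List ℕ → Bool
containsᵇ π τ = any (λ s → orderIso s τ) (subseqs π)

avoidsᵇ : List ℕ → List ℕ → Bool
avoidsᵇ π τ = not (containsᵇ π τ)

des : List ℕ → ℕ
des (a ∷ b ∷ r) = (if b <ᵇ a then 1 else 0) + des (b ∷ r)
des _           = 0

prefixIsInitial : List ℕ → ℕ → Bool
prefixIsInitial π i =
  all (λ x → memᵇ x (range1 i)) (take i π) ∧ all (λ j → memᵇ j (take i π)) (range1 i)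

indecomposableᵇ : List ℕ → Bool
indecomposableᵇ []          = false
indecomposableᵇ π@(_ ∷ rest) =
  all (λ i → not (prefixIsInitial π i)) (range1 (length rest)) ∧ prefixIsInitial π (length π)

count : (List ℕ → Bool) → List (List ℕ) → ℕ
count p xs = length (filterᵇ p xs)

p2143 : List ℕ
p2143 = 2 ∷ 1 ∷ 4 ∷ 3 ∷ []

p1234 : List ℕ
p1234 = 1 ∷ 2 ∷ 3 ∷ 4 ∷ []

A2143 : ℕ → ℕ → ℕ
A2143 n i = count (λ π → avoidsᵇ π p2143 ∧ (des π ≡ᵇ i)) (perms n)

I2143 : ℕ → ℕ → ℕ
I2143 n i = count (λ π → avoidsᵇ π p2143 ∧ indecomposableᵇ π ∧ (des π ≡ᵇ i)) (perms n)

I2143₁ : ℕ → ℕ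
I2143₁ n = count (λ π → avoidsᵇ π p2143 ∧ indecomposableᵇ π) (perms n)

E : ℕ → ℕ
E m = count (λ π → avoidsᵇ π p1234) (perms m)

-- Formal power series, represented by their coefficients in ℤ.
-- Bivariate: Ser2 F n i = [x^n q^i] F.   Univariate: Ser1 F n = [x^n] F.

Ser2 : Set
Ser2 = ℕ → ℕ → ℤ

Ser1 : Set
Ser1 = ℕ → ℤ

infixl 6 _⊕₂_ _⊖₂_ _⊕₁_

_⊕₂_ : Ser2 → Ser2 → Ser2
(F ⊕₂ G) n i = F n i ℤ.+ G n i

_⊖₂_ : Ser2 → Ser2 → Ser2
(F ⊖₂ G) n i = F n i - G n i

one₂ : Ser2
one₂ zero zero = + 1
one₂ _    _    = + 0

x₂ : Ser2
x₂ (suc zero) zero = + 1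
x₂ _          _    = + 0

xTimes₂ : Ser2 → Ser2
xTimes₂ F zero    i = + 0
xTimes₂ F (suc n) i = F n i

-- multiplication by 1/(1-x) = Σ_k x^k : partial sums in x
geom₂ : Ser2 → Ser2
geom₂ F zero    i = F zero i
geom₂ F (suc n) i = geom₂ F n i ℤ.+ F (suc n) i

Aser : Ser2
Aser zero    i = one₂ zero i
Aser (suc n) i = + A2143 (suc n) i

Iser : Ser2
Iser zero    i = + 0
Iser (suc n) i = + I2143 (suc n) i

_⊕₁_ : Ser1 → Ser1 → Ser1
(F ⊕₁ G) n = F n ℤ.+ G n

oneMinusX₁ : Ser1 → Ser1
oneMinusX₁ F zero    = F zero
oneMinusX₁ F (suc n) = F (suc n) - F n

twoXMinusOne : Ser1
twoXMinusOne zero          = ℤ.-[1+ 0 ]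
twoXMinusOne (suc zero)    = + 2
twoXMinusOne _             = + 0

Iser₁ : Ser1
Iser₁ zero    = + 0
Iser₁ (suc n) = + I2143₁ (suc n)

Eser : Ser1
Eser m = + E m

{-# OPTIONS --safe #-}
module Submission where

-- A 2143-avoider of length at least 2 is decomposable iff it starts with 1 or ends with its
-- maximum: otherwise the first entry, 1, the maximum and the last entry, split by an initial
-- prefix, form a 2143.  Both entries can be deleted and reinserted freely without changing the
-- descents, so inclusion-exclusion gives I_n = A_n - 2 A_{n-1} + A_{n-2}, refined by descents;
-- the equation for A(x,q) is the summed form of this recurrence.
--
-- That A_n(1) = E_n follows from a common generating tree: a permutation grows by prepending a
-- value and moving up the entries that are not smaller.  Label an avoider by x, the number of
-- new first entries that start no 123 (resp. 132), and z, the number of the other first entries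
-- that start no 1234 (resp. 2143).  In both cases the children of (x , z) are
-- (k + 2 , x - 1 - k + z) for k < x and (x , r + 1) for r < z.

open import Defs
open import Data.Bool using (Bool; true; false; T; _∧_; _∨_; not; if_then_else_)
open import Data.Bool.Properties using (T-∧; T-∨; T-≡; T?; ∨-identityʳ; ∨-zeroʳ; ∧-identityʳ; ∧-zeroʳ)
open import Data.Empty using (⊥-elim)
open import Data.Nat as ℕ using (ℕ; zero; suc; _≥_; _∸_; _≤_; _<_; _⊔_; z≤n; s≤s; z<s; s<s; s≤s⁻¹; _<ᵇ_; _≡ᵇ_)
open import Data.Nat.ListAction using (sum)
open import Data.Nat.ListAction.Properties using (sum-++; sum-↭)
open import Data.Nat.Properties
import Data.Nat.Solver
open import Data.List using (List; []; _∷_; _++_; [_]; length; map; concatMap; filterᵇ; downFrom; take; drop; initLast; _∷ʳ′_; cartesianProductWith)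
open import Data.List.Properties using (length-map; length-++; ++-assoc; ++-identityʳ; ++-cancelʳ; take++drop≡id; map-++; map-∘; ∷-injective; map-injective)
open import Data.List.Membership.Propositional using (_∈_; _∉_; find; lose)
open import Data.List.Membership.Propositional.Properties
open import Data.List.Membership.Propositional.Properties.WithK using (unique∧set⇒bag)
open import Data.List.Relation.Binary.BagAndSetEquality using (∼bag⇒↭)
open import Data.List.Relation.Binary.Permutation.Propositional using (_↭_)
import Data.List.Relation.Binary.Permutation.Propositional.Properties as ↭
open import Data.List.Relation.Unary.All as All using (All; []; _∷_)
import Data.List.Relation.Unary.All.Properties as All
open import Data.List.Relation.Unary.Any as Any using (Any; here; there)
import Data.List.Relation.Unary.Any.Properties as Any
open import Data.List.Relation.Unary.AllPairs using ([]; _∷_)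
open import Data.List.Relation.Unary.Linked using (Linked; [-]; _∷_)
open import Data.List.Relation.Binary.Sublist.Propositional using (_⊆_; []; _∷_; _∷ʳ_; lookup; minimum; to∈; from∈; ⊆-refl; ⊆-trans)
import Data.List.Relation.Binary.Sublist.Propositional.Properties as Sublist
open import Data.List.Relation.Unary.Unique.Propositional using (Unique)
import Data.List.Relation.Unary.Unique.Propositional.Properties as Unique
open import Data.Integer using (+_; _-_; _+_; _*_)
open import Data.Integer.Tactic.RingSolver using (solve-∀)
open import Data.Product using (_×_; _,_; ∃; ∃₂; proj₁; proj₂; swap)
open import Data.Sum using (_⊎_; inj₁; inj₂)
open import Function using (_∘_; _⇔_; mk⇔; Equivalence; flip)
open import Relation.Binary.Definitions using (tri<; tri≈; tri>)
open import Relation.Nullary using (¬_)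
open import Relation.Binary.PropositionalEquality
  using (_≡_; _≢_; refl; sym; trans; cong; cong₂; subst; ≢-sym; module ≡-Reasoning)

open Equivalence using (to; from)
module ℕ-Solver = Data.Nat.Solver.+-*-Solver

-- Permutations

memᵇ⇔∈ : ∀ x ys → T (memᵇ x ys) ⇔ x ∈ ys
memᵇ⇔∈ x ys = mk⇔ (Any.map (≡ᵇ⇒≡ x _) ∘ Any.any⁻ _ ys) (Any.any⁺ _ ∘ Any.map (≡⇒≡ᵇ x _))

T-not : ∀ {b} → T (not b) ⇔ (¬ T b)
T-not {true}  = mk⇔ (λ ()) (λ ¬t → ¬t _)
T-not {false} = mk⇔ (λ _ ()) (λ _ → _)

distinctᵇ⇔Unique : ∀ xs → T (distinctᵇ xs) ⇔ Unique xs
distinctᵇ⇔Unique []       = mk⇔ (λ _ → []) _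
distinctᵇ⇔Unique (x ∷ xs) = mk⇔ ⇒ ⇐
  where
  ⇒ : T (distinctᵇ (x ∷ xs)) → Unique (x ∷ xs)
  ⇒ t with x∉xs , d ← to T-∧ t =
    All.¬Any⇒All¬ xs (to T-not x∉xs ∘ from (memᵇ⇔∈ x xs)) ∷ to (distinctᵇ⇔Unique xs) d
  ⇐ : Unique (x ∷ xs) → T (distinctᵇ (x ∷ xs))
  ⇐ (x≢ ∷ u) = from T-∧
    (from T-not (λ t → All.All¬⇒¬Any x≢ (to (memᵇ⇔∈ x xs) t)) , from (distinctᵇ⇔Unique xs) u)

-- The product form gives access to the membership and uniqueness lemmas for `cartesianProductWith`.
words-suc : ∀ k xs → words (suc k) xs ≡ cartesianProductWith _∷_ xs (words k xs)
words-suc k xs = go xs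
  where
  go : ∀ ys → concatMap (λ a → map (a ∷_) (words k xs)) ys ≡ cartesianProductWith _∷_ ys (words k xs)
  go []       = refl
  go (y ∷ ys) = cong (_ ++_) (go ys)

words-unique : ∀ k {xs} → Unique xs → Unique (words k xs)
words-unique zero    u = [] ∷ []
words-unique (suc k) {xs} u rewrite words-suc k xs =
  Unique.cartesianProductWith⁺ _∷_ ∷-injective u (words-unique k u)

∈-words : ∀ k xs {w} → w ∈ words k xs ⇔ (length w ≡ k × All (_∈ xs) w)
∈-words zero    xs = mk⇔ (λ { (here refl) → refl , [] }) (λ { (_ , []) → here refl })
∈-words (suc k) xs rewrite words-suc k xs = mk⇔ ⇒ ⇐
  where
  ⇒ : ∀ {w} → w ∈ cartesianProductWith _∷_ xs (words k xs) → length w ≡ suc k × All (_∈ xs) w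
  ⇒ w∈ with _ , _ , a∈ , v∈ , refl ← ∈-cartesianProductWith⁻ _∷_ xs (words k xs) w∈
       with l , av ← to (∈-words k xs) v∈ = cong suc l , a∈ ∷ av
  ⇐ : ∀ {w} → length w ≡ suc k × All (_∈ xs) w → w ∈ cartesianProductWith _∷_ xs (words k xs)
  ⇐ (l , a∈ ∷ av) = ∈-cartesianProductWith⁺ _∷_ a∈ (from (∈-words k xs) (suc-injective l , av))

record IsPerm (n : ℕ) (w : List ℕ) : Set where
  constructor perm
  field
    len    : length w ≡ n
    bounds : All (λ v → 0 < v × v ≤ n) w
    unique : Unique w

open IsPerm

∈-range1 : ∀ n {v} → v ∈ range1 n ⇔ (0 < v × v ≤ n)
∈-range1 n = mk⇔ (λ v∈ → ⇒ (∈-applyUpTo⁻ suc v∈)) (λ { (z<s , v≤n) → ∈-applyUpTo⁺ suc v≤n })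
  where
  ⇒ : ∀ {v} → ∃ (λ i → i < n × v ≡ suc i) → 0 < v × v ≤ n
  ⇒ (_ , i<n , refl) = z<s , i<n

∈-perms : ∀ n {w} → w ∈ perms n ⇔ IsPerm n w
∈-perms n {w} = mk⇔ ⇒ ⇐
  where
  ⇒ : w ∈ perms n → IsPerm n w
  ⇒ w∈ with w∈′ , d ← ∈-filter⁻ (T? ∘ distinctᵇ) w∈ with l , a ← to (∈-words n _) w∈′ =
    perm l (All.map (to (∈-range1 n)) a) (to (distinctᵇ⇔Unique w) d)
  ⇐ : IsPerm n w → w ∈ perms n
  ⇐ p = ∈-filter⁺ (T? ∘ distinctᵇ)
    (from (∈-words n _) (len p , All.map (from (∈-range1 n)) (bounds p)))
    (from (distinctᵇ⇔Unique w) (unique p))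

perms-unique : ∀ n → Unique (perms n)
perms-unique n = Unique.filter⁺ (T? ∘ distinctᵇ)
  (words-unique n (Unique.applyUpTo⁺₁ suc n (λ i<j _ → <⇒≢ i<j ∘ suc-injective)))

-- Without repetitions every multiplicity is 0 or 1, so membership alone determines a list up to
-- order. Sums over two enumerations can then be compared by membership.
unique-↭ : {A : Set} {xs ys : List A} → Unique xs → Unique ys →
           (∀ {x} → x ∈ xs ⇔ x ∈ ys) → xs ↭ ys
unique-↭ u v e = ∼bag⇒↭ (unique∧set⇒bag u v e)

-- Inserting a first entry

shift : ℕ → ℕ → ℕ
shift j v = if j <ᵇ v then suc v else v

shift-suc : ∀ j v → ∃ λ u → shift j (suc v) ≡ suc u
shift-suc j v with j <ᵇ suc v
... | true  = suc v , refl
... | false = v , refl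

data ShiftView (j v : ℕ) : Set where
  low  : v ≤ j → shift j v ≡ v     → ShiftView j v
  high : j < v → shift j v ≡ suc v → ShiftView j v

shiftView : ∀ j v → ShiftView j v
shiftView j v with j <ᵇ v in eq
... | true  = high (<ᵇ⇒< j v (subst T (sym eq) _)) (cong (λ b → if b then suc v else v) eq)
... | false = low (≮⇒≥ (λ j<v → subst T eq (<⇒<ᵇ j<v))) (cong (λ b → if b then suc v else v) eq)

shift-low : ∀ {j v} → v ≤ j → shift j v ≡ v
shift-low {j} {v} v≤j with shiftView j v
... | low  _ e   = e
... | high j<v _ = ⊥-elim (<⇒≱ j<v v≤j)

shift-high : ∀ {j v} → j < v → shift j v ≡ suc v
shift-high {j} {v} j<v with shiftView j v
... | low v≤j _ = ⊥-elim (<⇒≱ j<v v≤j)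
... | high _ e  = e

StrictlyMonotone : (ℕ → ℕ) → Set
StrictlyMonotone f = ∀ {u v} → u < v → f u < f v

shift-mono : ∀ j → StrictlyMonotone (shift j)
shift-mono j {u} {v} u<v with shiftView j u | shiftView j v
... | low _ e   | low _ e′   rewrite e | e′ = u<v
... | low _ e   | high _ e′  rewrite e | e′ = m<n⇒m<1+n u<v
... | high j<u _ | low v≤j _ = ⊥-elim (<⇒≱ (<-trans j<u u<v) v≤j)
... | high _ e  | high _ e′  rewrite e | e′ = s<s u<v

strict⇒injective : ∀ {f} → StrictlyMonotone f → ∀ {u v} → f u ≡ f v → u ≡ v
strict⇒injective {f} f< {u} {v} e with <-cmp u v
... | tri< u<v _ _ = ⊥-elim (<⇒≢ (f< u<v) e)
... | tri≈ _ u≡v _ = u≡v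
... | tri> _ _ v<u = ⊥-elim (<⇒≢ (f< v<u) (sym e))

shift-≢ : ∀ j v → suc j ≢ shift j v
shift-≢ j v e with shiftView j v
... | low v≤j e′  = <⇒≱ (≤-reflexive (trans e e′)) v≤j
... | high j<v e′ = <⇒≢ j<v (suc-injective (trans e e′))

-- Together with `shift-≢`: the one value that `shift j` misses is `suc j`, so a first entry `suc j`
-- can be deleted and the gap closed.
unshift : ∀ j {v} → v ≢ suc j → ∃ λ u → v ≡ shift j u
unshift j {v} v≢ with <-cmp v (suc j)
... | tri< (s≤s v≤j) _ _ = v , sym (shift-low v≤j)
... | tri≈ _ v≡ _        = ⊥-elim (v≢ v≡)
unshift j {suc v} v≢ | tri> _ _ (s<s j<v) = v , sym (shift-high j<v)

-- Sites are counted from 0: cons j w prepends the value j + 1.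
cons : ℕ → List ℕ → List ℕ
cons j w = suc j ∷ map (shift j) w

cons-injective : ∀ {i j v w} → cons i v ≡ cons j w → i ≡ j × v ≡ w
cons-injective {i} e with e₁ , e₂ ← ∷-injective e with refl ← suc-injective e₁ =
  refl , map-injective (strict⇒injective (shift-mono i)) e₂

cons-perm : ∀ {n j w} → j ≤ n → IsPerm n w → IsPerm (suc n) (cons j w)
cons-perm {n} {j} {w} j≤n (perm l b u) = perm
  (cong suc (trans (length-map (shift j) w) l))
  ((z<s , s≤s j≤n) ∷ All.map⁺ (All.map bound b))
  (All.map⁺ (All.universal (shift-≢ j) _) ∷ Unique.map⁺ (strict⇒injective (shift-mono j)) u)
  where
  bound : ∀ {v} → 0 < v × v ≤ n → 0 < shift j v × shift j v ≤ suc n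
  bound {v} (0<v , v≤n) with shiftView j v
  ... | low  _ e rewrite e = 0<v , m≤n⇒m≤1+n v≤n
  ... | high _ e rewrite e = z<s , s≤s v≤n

unmap : ∀ {f : ℕ → ℕ} {xs} → All (λ v → ∃ λ u → v ≡ f u) xs → ∃ λ ys → xs ≡ map f ys
unmap []                = [] , refl
unmap ((u , refl) ∷ as) with ys , refl ← unmap as = u ∷ ys , refl

cons-perm⁻ : ∀ {n w} → IsPerm (suc n) w → ∃₂ λ j v → j ≤ n × IsPerm n v × w ≡ cons j v
cons-perm⁻ {n} (perm l ((z<s {j} , s≤s j≤n) ∷ b) (x≢ ∷ u))
  with v , refl ← unmap (All.map (λ ne → unshift j (ne ∘ sym)) x≢) =
  j , v , j≤n , perm (trans (sym (length-map (shift j) v)) (suc-injective l))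
    (All.map bound (All.map⁻ b)) (Unique.map⁻ u) , refl
  where
  bound : ∀ {v} → 0 < shift j v × shift j v ≤ suc n → 0 < v × v ≤ n
  bound {v} (0<s , s≤n) with shiftView j v
  ... | low v≤j e = subst (0 <_) e 0<s , ≤-trans v≤j j≤n
  ... | high j<v e rewrite e = ≤-<-trans z≤n j<v , s≤s⁻¹ s≤n

-- Deleting the first entry inverts `cons`. The parent is the outer index of the product, so a sum
-- over `perms (suc n)` becomes a sum over parents of sums over sites.
perms-suc : ∀ n → perms (suc n) ↭ cartesianProductWith (flip cons) (perms n) (downFrom (suc n))
perms-suc n = unique-↭ (perms-unique (suc n))
  (Unique.cartesianProductWith⁺ (flip cons) (swap ∘ cons-injective) (perms-unique n) (Unique.downFrom⁺ (suc n)))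
  (mk⇔ ⇒ ⇐)
  where
  ⇒ : ∀ {w} → w ∈ perms (suc n) → w ∈ cartesianProductWith (flip cons) (perms n) (downFrom (suc n))
  ⇒ w∈ with j , v , j≤n , p , refl ← cons-perm⁻ (to (∈-perms (suc n)) w∈) =
    ∈-cartesianProductWith⁺ (flip cons) (from (∈-perms n) p) (∈-downFrom⁺ (s≤s j≤n))
  ⇐ : ∀ {w} → w ∈ cartesianProductWith (flip cons) (perms n) (downFrom (suc n)) → w ∈ perms (suc n)
  ⇐ w∈ with _ , _ , v∈ , j∈ , refl ← ∈-cartesianProductWith⁻ (flip cons) (perms n) (downFrom (suc n)) w∈ =
    from (∈-perms (suc n)) (cons-perm (s≤s⁻¹ (∈-downFrom⁻ j∈)) (to (∈-perms n) v∈))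

-- Pigeonhole by deleting the first entry `suc j`: smaller values come from themselves in the
-- shorter permutation, larger ones from their predecessors.
perm-surjective : ∀ {n w v} → IsPerm n w → 0 < v → v ≤ n → v ∈ w
perm-surjective {zero}  p 0<v v≤n = ⊥-elim (<⇒≱ 0<v v≤n)
perm-surjective {suc n} {v = v} p 0<v v≤n with cons-perm⁻ p
... | j , w , j≤n , q , refl with <-cmp v (suc j)
... | tri< (s≤s v≤j) _ _ = there (subst (_∈ map (shift j) w) (shift-low v≤j)
        (∈-map⁺ (shift j) (perm-surjective q 0<v (≤-trans v≤j j≤n))))
... | tri≈ _ refl _ = here refl
perm-surjective {suc n} {v = suc v} p 0<v v≤n | j , w , j≤n , q , refl | tri> _ _ (s<s j<v) =
  there (subst (_∈ map (shift j) w) (shift-high j<v)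
    (∈-map⁺ (shift j) (perm-surjective q (≤-<-trans z≤n j<v) (s≤s⁻¹ v≤n))))

-- Pattern containment

bool-ext : ∀ {a b} → (T a ⇔ T b) → a ≡ b
bool-ext {true}  {true}  e = refl
bool-ext {true}  {false} e = ⊥-elim (to e _)
bool-ext {false} {true}  e = ⊥-elim (from e _)
bool-ext {false} {false} e = refl

-- The append in the definition of subseqs is local to it; the underscore in
-- the type of append-≡ is solved to that function.
mutual
  subseqs-∷ : ∀ x xs → subseqs (x ∷ xs) ≡ map (x ∷_) (subseqs xs) ++ subseqs xs
  subseqs-∷ x xs with subseqs xs
  ... | zs with map (x List.∷_) zs
  ...   | ys = append-≡ x xs ys zs

  append-≡ : ∀ (x : ℕ) (xs : List ℕ) (ys zs : List (List ℕ)) → _ ≡ ys ++ zs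
  append-≡ x xs []       zs = refl
  append-≡ x xs (y ∷ ys) zs = cong (y ∷_) (append-≡ x xs ys zs)

∈-subseqs : ∀ {s} w → s ∈ subseqs w ⇔ s ⊆ w
∈-subseqs []      = mk⇔ (λ { (here refl) → [] }) (λ { [] → here refl })
∈-subseqs {s} (x ∷ w) rewrite subseqs-∷ x w = mk⇔ ⇒ ⇐
  where
  ⇒ : ∀ {s} → s ∈ map (x ∷_) (subseqs w) ++ subseqs w → s ⊆ x ∷ w
  ⇒ s∈ with ∈-++⁻ (map (x ∷_) (subseqs w)) s∈
  ... | inj₂ s∈w = x ∷ʳ to (∈-subseqs w) s∈w
  ... | inj₁ s∈x with _ , s∈w , refl ← ∈-map⁻ (x ∷_) s∈x = refl ∷ to (∈-subseqs w) s∈w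
  ⇐ : ∀ {s} → s ⊆ x ∷ w → s ∈ map (x ∷_) (subseqs w) ++ subseqs w
  ⇐ (_ ∷ʳ p)   = ∈-++⁺ʳ (map (x ∷_) (subseqs w)) (from (∈-subseqs w) p)
  ⇐ (refl ∷ p) = ∈-++⁺ˡ (∈-map⁺ (x ∷_) (from (∈-subseqs w) p))

contains⇔ : ∀ w τ → T (containsᵇ w τ) ⇔ ∃ λ s → s ⊆ w × T (orderIso s τ)
contains⇔ w τ = mk⇔ ⇒ ⇐
  where
  ⇒ : T (containsᵇ w τ) → ∃ λ s → s ⊆ w × T (orderIso s τ)
  ⇒ t with s , s∈ , o ← find (Any.any⁻ _ (subseqs w) t) = s , to (∈-subseqs w) s∈ , o
  ⇐ : (∃ λ s → s ⊆ w × T (orderIso s τ)) → T (containsᵇ w τ)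
  ⇐ (s , p , o) = Any.any⁺ _ (lose (from (∈-subseqs w) p) o)

<⇒<ᵇ≡true : ∀ {m n} → m < n → (m <ᵇ n) ≡ true
<⇒<ᵇ≡true m<n = to T-≡ (<⇒<ᵇ m<n)

≤⇒<ᵇ≡false : ∀ {m n} → n ≤ m → (m <ᵇ n) ≡ false
≤⇒<ᵇ≡false {m} {n} n≤m with m <ᵇ n in eq
... | false = refl
... | true  = ⊥-elim (<⇒≱ (<ᵇ⇒< m n (from T-≡ eq)) n≤m)

≢⇒≡ᵇ≡false : ∀ {m n} → m ≢ n → (m ≡ᵇ n) ≡ false
≢⇒≡ᵇ≡false {m} {n} m≢n with m ≡ᵇ n in eq
... | false = refl
... | true  = ⊥-elim (m≢n (≡ᵇ⇒≡ m n (from T-≡ eq)))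

sameOrder-< : ∀ {x y a b} → a < b → T (sameOrder x y a b) ⇔ x < y
sameOrder-< {x} {y} {a} {b} a<b = mk⇔ ⇒ ⇐
  where
  ⇒ : T (sameOrder x y a b) → x < y
  ⇒ t rewrite <⇒<ᵇ≡true a<b with x <ᵇ y in eq | t
  ... | true | _ = <ᵇ⇒< x y (from T-≡ eq)
  ⇐ : x < y → T (sameOrder x y a b)
  ⇐ x<y rewrite <⇒<ᵇ≡true a<b | ≢⇒≡ᵇ≡false (<⇒≢ a<b) | <⇒<ᵇ≡true x<y | ≢⇒≡ᵇ≡false (<⇒≢ x<y) = _

sameOrder-> : ∀ {x y a b} → b < a → T (sameOrder x y a b) ⇔ y < x
sameOrder-> {x} {y} {a} {b} b<a = mk⇔ ⇒ ⇐
  where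
  ⇒ : T (sameOrder x y a b) → y < x
  ⇒ t rewrite ≤⇒<ᵇ≡false (<⇒≤ b<a) | ≢⇒≡ᵇ≡false (≢-sym (<⇒≢ b<a))
    with x <ᵇ y in eq | x ≡ᵇ y in eq′ | t
  ... | false | false | _ = ≤∧≢⇒< (≮⇒≥ (subst T eq ∘ <⇒<ᵇ)) (subst T eq′ ∘ ≡⇒≡ᵇ x y ∘ sym)
  ⇐ : y < x → T (sameOrder x y a b)
  ⇐ y<x rewrite ≤⇒<ᵇ≡false (<⇒≤ b<a) | ≢⇒≡ᵇ≡false (≢-sym (<⇒≢ b<a))
              | ≤⇒<ᵇ≡false (<⇒≤ y<x) | ≢⇒≡ᵇ≡false (≢-sym (<⇒≢ y<x)) = _

-- The largest first entry of an increasing subsequence of length k + 1, or 0 if there is none.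
top : ℕ → List ℕ → ℕ
top k       []      = 0
top zero    (v ∷ w) = v ⊔ top zero w
top (suc k) (v ∷ w) = (if v <ᵇ top k w then v else 0) ⊔ top (suc k) w

top-∷ : ∀ k v w → top k w ≤ top k (v ∷ w)
top-∷ zero    v w = m≤n⊔m v _
top-∷ (suc k) v w = m≤n⊔m (if v <ᵇ top k w then v else 0) _

-- With `<top⇒⊆` this characterises `top` in the form that insertion uses: `v` is a prospective
-- first entry, and `v ∷ s` the chain that it would start.
⊆⇒<top : ∀ {v s w} k → s ⊆ w → length s ≡ suc k → Linked _<_ (v ∷ s) → v < top k w
⊆⇒<top k (y ∷ʳ p) l i = <-≤-trans (⊆⇒<top k p l i) (top-∷ k y _)
⊆⇒<top zero    (refl ∷ p) l (v<x ∷ i) = <-≤-trans v<x (m≤m⊔n _ _)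
⊆⇒<top {w = x ∷ w} (suc k) (refl ∷ p) l (v<x ∷ i)
  rewrite <⇒<ᵇ≡true (⊆⇒<top k p (suc-injective l) i) = <-≤-trans v<x (m≤m⊔n x (top (suc k) w))

<⊔ : ∀ {v} m n → v < m ⊔ n → v < m ⊎ v < n
<⊔ m n v< with ⊔-sel m n
... | inj₁ e = inj₁ (subst (_ <_) e v<)
... | inj₂ e = inj₂ (subst (_ <_) e v<)

<top⇒⊆ : ∀ {v} k w → v < top k w → ∃ λ s → s ⊆ w × length s ≡ suc k × Linked _<_ (v ∷ s)
<top⇒⊆ zero (x ∷ w) v< with <⊔ x _ v<
... | inj₁ v<x = x ∷ [] , refl ∷ minimum w , refl , v<x ∷ [-]
... | inj₂ v<w with s , p , l ← <top⇒⊆ zero w v<w = s , x ∷ʳ p , l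
<top⇒⊆ (suc k) (x ∷ w) v< with x <ᵇ top k w in eq
... | false with s , p , l ← <top⇒⊆ (suc k) w v< = s , x ∷ʳ p , l
... | true with <⊔ x _ v<
...   | inj₂ v<w with s , p , l ← <top⇒⊆ (suc k) w v<w = s , x ∷ʳ p , l
...   | inj₁ v<x with s , p , l , i ← <top⇒⊆ k w (<ᵇ⇒< x _ (from T-≡ eq)) =
  x ∷ s , refl ∷ p , cong suc l , v<x ∷ i

orderIso-length : ∀ s τ → T (orderIso s τ) → length s ≡ length τ
orderIso-length []      []      o = refl
orderIso-length (x ∷ s) (a ∷ τ) o = cong suc (orderIso-length s τ (proj₂ (to T-∧ o)))

-- As 0 encodes the absence of a chain, the entries have to be positive. From left to right only
-- comparisons of neighbours are read off; the way back supplies all six.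
contains-1234 : ∀ {w} → All (0 <_) w → T (containsᵇ w p1234) ⇔ 0 < top 3 w
contains-1234 {w} pos = mk⇔ ⇒ ⇐
  where
  ⇒ : T (containsᵇ w p1234) → 0 < top 3 w
  ⇒ t with s , p , o ← to (contains⇔ w p1234) t with l ← orderIso-length s p1234 o
      with a ∷ b ∷ c ∷ d ∷ [] ← s =
    let oa , o′ = to T-∧ o
        ob , o″ = to T-∧ o′
        oc , _  = to T-∧ o″
        0<a = All.lookup pos (lookup p (here refl))
        a<b = to (sameOrder-< {a = 1} {2} (s<s z<s)) (proj₁ (to T-∧ oa))
        b<c = to (sameOrder-< {a = 2} {3} (s<s (s<s z<s))) (proj₁ (to T-∧ ob))
        c<d = to (sameOrder-< {a = 3} {4} (s<s (s<s (s<s z<s)))) (proj₁ (to T-∧ oc))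
    in ⊆⇒<top 3 p l (0<a ∷ a<b ∷ b<c ∷ c<d ∷ [-])
  ⇐ : 0 < top 3 w → T (containsᵇ w p1234)
  ⇐ 0<t with s , p , l , i ← <top⇒⊆ 3 w 0<t
        with a ∷ b ∷ c ∷ d ∷ [] ← s
        with 0<a ∷ a<b ∷ b<c ∷ c<d ∷ [-] ← i =
    from (contains⇔ w p1234) (_ , p , from T-∧
      ( from T-∧ (lt 1 2 _ a<b , from T-∧ (lt 1 3 _ a<c , from T-∧ (lt 1 4 _ (<-trans a<c c<d) , _)))
      , from T-∧ ( from T-∧ (lt 2 3 _ b<c , from T-∧ (lt 2 4 _ (<-trans b<c c<d) , _))
                 , from T-∧ (from T-∧ (lt 3 4 _ c<d , _) , _))))
    where
    a<c = <-trans a<b b<c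
    lt : ∀ i j {x y} → T (i <ᵇ j) → x < y → T (sameOrder x y i j)
    lt i j i<j = from (sameOrder-< (<ᵇ⇒< i j i<j))

avoids-1234 : ∀ {w} → All (0 <_) w → avoidsᵇ w p1234 ≡ (top 3 w ≡ᵇ 0)
avoids-1234 {w} pos = bool-ext (mk⇔
  (λ t → ≡⇒≡ᵇ _ 0 (n≤0⇒n≡0 (≮⇒≥ (to T-not t ∘ from (contains-1234 pos)))))
  (λ e → from T-not (λ t → <⇒≢ (to (contains-1234 pos) t) (sym (≡ᵇ⇒≡ (top 3 w) 0 e)))))

-- The largest entry below d, or 0 if there is none.
below : ℕ → List ℕ → ℕ
below d []      = 0
below d (c ∷ w) = (if c <ᵇ d then c else 0) ⊔ below d w

-- The largest smaller entry of an inversion, or 0 if there is none.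
bottom : List ℕ → ℕ
bottom []      = 0
bottom (d ∷ w) = below d w ⊔ bottom w

<below⇔ : ∀ {v} d w → v < below d w ⇔ (∃ λ c → c ∈ w × v < c × c < d)
<below⇔ d []      = mk⇔ (λ ()) (λ ())
<below⇔ {v} d (c ∷ w) = mk⇔ ⇒ ⇐
  where
  ⇒ : v < below d (c ∷ w) → ∃ λ c′ → c′ ∈ c ∷ w × v < c′ × c′ < d
  ⇒ v< with c <ᵇ d in eq
  ... | false with x , x∈ , q ← to (<below⇔ d w) v< = x , there x∈ , q
  ... | true with <⊔ c _ v<
  ...   | inj₁ v<c = c , here refl , v<c , <ᵇ⇒< c d (from T-≡ eq)
  ...   | inj₂ v<w with x , x∈ , q ← to (<below⇔ d w) v<w = x , there x∈ , q
  ⇐ : (∃ λ c′ → c′ ∈ c ∷ w × v < c′ × c′ < d) → v < below d (c ∷ w)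
  ⇐ (_ , here refl , v<c , c<d) rewrite <⇒<ᵇ≡true c<d = <-≤-trans v<c (m≤m⊔n c _)
  ⇐ (x , there x∈ , q) = <-≤-trans (from (<below⇔ d w) (x , x∈ , q)) (m≤n⊔m (if c <ᵇ d then c else 0) _)

<bottom⇔ : ∀ {v} w → v < bottom w ⇔ (∃₂ λ d c → d ∷ c ∷ [] ⊆ w × v < c × c < d)
<bottom⇔ [] = mk⇔ (λ ()) (λ { (_ , _ , () , _) })
<bottom⇔ {v} (d ∷ w) = mk⇔ ⇒ ⇐
  where
  ⇒ : v < bottom (d ∷ w) → ∃₂ λ d′ c → d′ ∷ c ∷ [] ⊆ d ∷ w × v < c × c < d′
  ⇒ v< with <⊔ (below d w) (bottom w) v<
  ... | inj₁ v<d with c , c∈ , q ← to (<below⇔ d w) v<d = d , c , refl ∷ from∈ c∈ , q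
  ... | inj₂ v<w with d′ , c , p , q ← to (<bottom⇔ w) v<w = d′ , c , d ∷ʳ p , q
  ⇐ : (∃₂ λ d′ c → d′ ∷ c ∷ [] ⊆ d ∷ w × v < c × c < d′) → v < bottom (d ∷ w)
  ⇐ (d′ , c , _ ∷ʳ p , q)    = <-≤-trans (from (<bottom⇔ w) (d′ , c , p , q)) (m≤n⊔m (below d w) _)
  ⇐ (d′ , c , refl ∷ p , q) = <-≤-trans (from (<below⇔ d w) (c , to∈ p , q)) (m≤m⊔n (below d w) _)

-- Is an entry a < lo followed by an inversion (d , c) with hi < c?
split : ℕ → ℕ → List ℕ → Bool
split lo hi []      = false
split lo hi (a ∷ w) = ((a <ᵇ lo) ∧ (hi <ᵇ bottom w)) ∨ split lo hi w

-- Here `b` is both bounds of `split`. They are separate parameters because a site `e` that is not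
-- yet filled bounds `a` by `suc e` and `c` by `e`.
has2143 : List ℕ → Bool
has2143 []      = false
has2143 (b ∷ w) = split b b w ∨ has2143 w

split⇔ : ∀ lo hi w → T (split lo hi w) ⇔
         (∃ λ a → ∃₂ λ d c → a ∷ d ∷ c ∷ [] ⊆ w × a < lo × hi < c × c < d)
split⇔ lo hi [] = mk⇔ (λ ()) (λ { (_ , _ , _ , () , _) })
split⇔ lo hi (x ∷ w) = mk⇔ ⇒ ⇐
  where
  ⇒ : T (split lo hi (x ∷ w)) → ∃ λ a → ∃₂ λ d c → a ∷ d ∷ c ∷ [] ⊆ x ∷ w × a < lo × hi < c × c < d
  ⇒ t with to T-∨ t
  ... | inj₂ t′ with a , d , c , p , q ← to (split⇔ lo hi w) t′ = a , d , c , x ∷ʳ p , q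
  ... | inj₁ t′ with x<lo , hi< ← to T-∧ t′
                with d , c , p , q ← to (<bottom⇔ w) (<ᵇ⇒< hi (bottom w) hi<) =
    x , d , c , refl ∷ p , <ᵇ⇒< x lo x<lo , q
  ⇐ : (∃ λ a → ∃₂ λ d c → a ∷ d ∷ c ∷ [] ⊆ x ∷ w × a < lo × hi < c × c < d) → T (split lo hi (x ∷ w))
  ⇐ (a , d , c , _ ∷ʳ p , q) = from T-∨ (inj₂ (from (split⇔ lo hi w) (a , d , c , p , q)))
  ⇐ (a , d , c , refl ∷ p , a<lo , q) = from T-∨ (inj₁ (from T-∧
    (<⇒<ᵇ a<lo , <⇒<ᵇ (from (<bottom⇔ w) (d , c , p , q)))))

has2143⇔ : ∀ w → T (has2143 w) ⇔
           (∃₂ λ b a → ∃₂ λ d c → b ∷ a ∷ d ∷ c ∷ [] ⊆ w × a < b × b < c × c < d)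
has2143⇔ [] = mk⇔ (λ ()) (λ { (_ , _ , _ , _ , () , _) })
has2143⇔ (x ∷ w) = mk⇔ ⇒ ⇐
  where
  ⇒ : T (has2143 (x ∷ w)) → ∃₂ λ b a → ∃₂ λ d c → b ∷ a ∷ d ∷ c ∷ [] ⊆ x ∷ w × a < b × b < c × c < d
  ⇒ t with to T-∨ t
  ... | inj₁ t′ with a , d , c , p , q ← to (split⇔ x x w) t′ = x , a , d , c , refl ∷ p , q
  ... | inj₂ t′ with b , a , d , c , p , q ← to (has2143⇔ w) t′ = b , a , d , c , x ∷ʳ p , q
  ⇐ : (∃₂ λ b a → ∃₂ λ d c → b ∷ a ∷ d ∷ c ∷ [] ⊆ x ∷ w × a < b × b < c × c < d) → T (has2143 (x ∷ w))
  ⇐ (b , a , d , c , _ ∷ʳ p , q)   = from T-∨ (inj₂ (from (has2143⇔ w) (b , a , d , c , p , q)))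
  ⇐ (b , a , d , c , refl ∷ p , q) = from T-∨ (inj₁ (from (split⇔ b b w) (a , d , c , p , q)))

-- The pattern is the chain a < b < c < d on the word b a d c. The comparisons 2-1, 2-3 and 4-3
-- yield the chain, and transitivity the other three.
contains-2143 : ∀ w → T (containsᵇ w p2143) ⇔ T (has2143 w)
contains-2143 w = mk⇔ ⇒ ⇐
  where
  ⇒ : T (containsᵇ w p2143) → T (has2143 w)
  ⇒ t with s , p , o ← to (contains⇔ w p2143) t with l ← orderIso-length s p2143 o
      with b ∷ a ∷ d ∷ c ∷ [] ← s =
    let ob , o′  = to (T-∧ {headCompat b (a ∷ d ∷ c ∷ []) 2 (1 ∷ 4 ∷ 3 ∷ [])}) o
        _  , o″  = to (T-∧ {headCompat a (d ∷ c ∷ []) 1 (4 ∷ 3 ∷ [])}) o′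
        od , _   = to (T-∧ {headCompat d (c ∷ []) 4 (3 ∷ [])}) o″
        ba , ob′ = to (T-∧ {sameOrder b a 2 1}) ob
        _  , ob″ = to (T-∧ {sameOrder b d 2 4}) ob′
        bc , _   = to (T-∧ {sameOrder b c 2 3}) ob″
        dc , _   = to (T-∧ {sameOrder d c 4 3}) od
    in from (has2143⇔ w) (b , a , d , c , p
         , to (sameOrder-> {a = 2} {1} (s<s z<s)) ba
         , to (sameOrder-< {a = 2} {3} (s<s (s<s z<s))) bc
         , to (sameOrder-> {a = 4} {3} (s<s (s<s (s<s z<s)))) dc)
  ⇐ : T (has2143 w) → T (containsᵇ w p2143)
  ⇐ t with b , a , d , c , p , a<b , b<c , c<d ← to (has2143⇔ w) t =
    from (contains⇔ w p2143) (_ , p , from T-∧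
      ( from T-∧ (gt 2 1 _ a<b , from T-∧ (lt 2 4 _ (<-trans b<c c<d) , from T-∧ (lt 2 3 _ b<c , _)))
      , from T-∧ ( from T-∧ (lt 1 4 _ (<-trans a<c c<d) , from T-∧ (lt 1 3 _ a<c , _))
                 , from T-∧ (from T-∧ (gt 4 3 _ c<d , _) , _))))
    where
    a<c = <-trans a<b b<c
    lt : ∀ i j {x y} → T (i <ᵇ j) → x < y → T (sameOrder x y i j)
    lt i j i<j = from (sameOrder-< (<ᵇ⇒< i j i<j))
    gt : ∀ i j {x y} → T (j <ᵇ i) → y < x → T (sameOrder x y i j)
    gt i j j<i = from (sameOrder-> (<ᵇ⇒< j i j<i))

avoids-2143 : ∀ w → avoidsᵇ w p2143 ≡ not (has2143 w)
avoids-2143 w = cong not (bool-ext (contains-2143 w))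

-- Sums

Σ< : ℕ → (ℕ → ℕ) → ℕ
Σ< zero    f = 0
Σ< (suc n) f = f n ℕ.+ Σ< n f

Σ<-cong : ∀ n {f g} → (∀ k → k < n → f k ≡ g k) → Σ< n f ≡ Σ< n g
Σ<-cong zero    e = refl
Σ<-cong (suc n) e = cong₂ ℕ._+_ (e n ≤-refl) (Σ<-cong n (λ k k<n → e k (m<n⇒m<1+n k<n)))

Σ<-const : ∀ n c → Σ< n (λ _ → c) ≡ n ℕ.* c
Σ<-const zero    c = refl
Σ<-const (suc n) c = cong (c ℕ.+_) (Σ<-const n c)

Σ<-+ : ∀ m n f → Σ< (m ℕ.+ n) f ≡ Σ< m f ℕ.+ Σ< n (λ k → f (m ℕ.+ k))
Σ<-+ m zero    f rewrite +-identityʳ m = sym (+-identityʳ _)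
Σ<-+ m (suc n) f rewrite +-suc m n | Σ<-+ m n f = +-left-comm (f (m ℕ.+ n)) (Σ< m f) _
  where
  +-left-comm : ∀ a b c → a ℕ.+ (b ℕ.+ c) ≡ b ℕ.+ (a ℕ.+ c)
  +-left-comm a b c = trans (sym (+-assoc a b c)) (trans (cong (ℕ._+ c) (+-comm a b)) (+-assoc b a c))

Σ<-reverse : ∀ n f → Σ< n f ≡ Σ< n (λ k → f (n ∸ suc k))
Σ<-reverse zero    f = refl
Σ<-reverse (suc n) f rewrite Σ<-+ 1 n (λ k → f (n ∸ k)) | +-identityʳ (f n) =
  cong (f n ℕ.+_) (Σ<-reverse n f)

indicator : Bool → ℕ
indicator b = if b then 1 else 0

rank : (ℕ → Bool) → ℕ → ℕ
rank p n = Σ< n (indicator ∘ p)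

-- Reindexing: as `j` runs through the places where `p` holds, `rank p j` takes each value below
-- `rank p n` exactly once.
Σ<-rank : ∀ n p g → Σ< n (λ j → if p j then g (rank p j) else 0) ≡ Σ< (rank p n) g
Σ<-rank zero    p g = refl
Σ<-rank (suc n) p g with p n
... | true  = cong (g (rank p n) ℕ.+_) (Σ<-rank n p g)
... | false = Σ<-rank n p g

sumOver : {A : Set} → List A → (A → ℕ) → ℕ
sumOver xs f = sum (map f xs)

sumOver-cong : {A : Set} (xs : List A) {f g : A → ℕ} → (∀ {x} → x ∈ xs → f x ≡ g x) → sumOver xs f ≡ sumOver xs g
sumOver-cong []       e = refl
sumOver-cong (x ∷ xs) e = cong₂ ℕ._+_ (e (here refl)) (sumOver-cong xs (e ∘ there))

sumOver-↭ : {A : Set} {xs ys : List A} (f : A → ℕ) → xs ↭ ys → sumOver xs f ≡ sumOver ys f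
sumOver-↭ f p = sum-↭ (↭.map⁺ f p)

sumOver-map : {A B : Set} (g : A → B) (xs : List A) (f : B → ℕ) → sumOver (map g xs) f ≡ sumOver xs (f ∘ g)
sumOver-map g xs f = cong sum (sym (map-∘ xs))

sumOver-downFrom : ∀ n f → sumOver (downFrom n) f ≡ Σ< n f
sumOver-downFrom zero    f = refl
sumOver-downFrom (suc n) f = cong (f n ℕ.+_) (sumOver-downFrom n f)

sumOver-product : {A B C : Set} (h : A → B → C) (xs : List A) (ys : List B) (f : C → ℕ) →
  sumOver (cartesianProductWith h xs ys) f ≡ sumOver xs (λ x → sumOver ys (f ∘ h x))
sumOver-product h []       ys f = refl
sumOver-product h (x ∷ xs) ys f
  rewrite map-++ f (map (h x) ys) (cartesianProductWith h xs ys)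
        | sum-++ (map f (map (h x) ys)) (map f (cartesianProductWith h xs ys)) =
  cong₂ ℕ._+_ (sumOver-map (h x) ys f) (sumOver-product h xs ys f)

sumOver-perms-suc : ∀ n f → sumOver (perms (suc n)) f ≡ sumOver (perms n) (λ w → Σ< (suc n) (λ j → f (cons j w)))
sumOver-perms-suc n f =
  trans (sumOver-↭ f (perms-suc n))
  (trans (sumOver-product (flip cons) (perms n) (downFrom (suc n)) f)
         (sumOver-cong (perms n) (λ {w} _ → sumOver-downFrom (suc n) (λ j → f (cons j w)))))

sumOver-+ : {A : Set} (xs : List A) (f g : A → ℕ) → sumOver xs (λ x → f x ℕ.+ g x) ≡ sumOver xs f ℕ.+ sumOver xs g
sumOver-+ []       f g = refl
sumOver-+ (x ∷ xs) f g rewrite sumOver-+ xs f g = ℕ-Solver.solve 4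
  (λ a b c d → a :+ b :+ (c :+ d) := a :+ c :+ (b :+ d)) refl (f x) (g x) (sumOver xs f) (sumOver xs g)
  where open ℕ-Solver using (_:+_; _:=_)

count-sum : ∀ p xs → count p xs ≡ sumOver xs (indicator ∘ p)
count-sum p []       = refl
count-sum p (x ∷ xs) with p x
... | true  = cong suc (count-sum p xs)
... | false = count-sum p xs

count-cong : ∀ {p q xs} → (∀ {x} → x ∈ xs → p x ≡ q x) → count p xs ≡ count q xs
count-cong {p} {q} {xs} e = trans (count-sum p xs)
  (trans (sumOver-cong xs (cong indicator ∘ e)) (sym (count-sum q xs)))

-- The generating tree

-- The number of descendants at depth d of a node labelled (x , z).
tree : ℕ → ℕ → ℕ → ℕ
tree zero    x z = 1
tree (suc d) x z = Σ< x (λ k → tree d (2 ℕ.+ k) ((x ∸ suc k) ℕ.+ z)) ℕ.+ Σ< z (λ r → tree d x (suc r))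

module Labelling
  (avoids : List ℕ → Bool) (X Z : List ℕ → ℕ)
  (avoids-[] : avoids [] ≡ true) (X-[] : X [] ≡ 1) (Z-[] : Z [] ≡ 0)
  where

  -- Non-avoiders have weight 0, so that sums may run over all permutations and all sites.
  weight : ℕ → List ℕ → ℕ
  weight d w = if avoids w then tree d (X w) (Z w) else 0

  module _ (step : ∀ d {n w} → IsPerm n w → Σ< (suc n) (λ j → weight d (cons j w)) ≡ weight (suc d) w) where

    -- Induction on `n` with `d` free: `step` trades one level of insertions for one more level of
    -- depth. The root is the empty permutation, labelled (1 , 0).
    sum-weight : ∀ n d → sumOver (perms n) (weight d) ≡ tree (n ℕ.+ d) 1 0
    sum-weight zero    d rewrite avoids-[] | X-[] | Z-[] = +-identityʳ _
    sum-weight (suc n) d =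
      trans (sumOver-perms-suc n (weight d))
      (trans (sumOver-cong (perms n) (λ w∈ → step d (to (∈-perms n) w∈)))
      (trans (sum-weight n (suc d)) (cong (λ m → tree m 1 0) (+-suc n d))))

    count-tree : ∀ n → count avoids (perms n) ≡ tree n 1 0
    count-tree n = trans (count-sum avoids (perms n))
      (trans (sum-weight n 0) (cong (λ m → tree m 1 0) (+-identityʳ n)))

-- For 1234: `s` sites without an avoiding child, then `z` sites giving (x , r + 1) with r falling
-- from z - 1 to 0, then x = m + 1 sites giving the other children. Among the latter the i-th has k
-- = m - 1 - i, except that the topmost has k = m.
tree-interval : ∀ d s z m h →
  (∀ j → j < s → h j ≡ 0) →
  (∀ k → k < z → h (s ℕ.+ k) ≡ tree d (suc m) (z ∸ k)) →
  (∀ i → i < m → h (s ℕ.+ z ℕ.+ i) ≡ tree d (suc (m ∸ i)) (suc i ℕ.+ z)) →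
  h (s ℕ.+ z ℕ.+ m) ≡ tree d (2 ℕ.+ m) z →
  Σ< (suc (s ℕ.+ z ℕ.+ m)) h ≡ tree (suc d) (suc m) z
tree-interval d s z m h e₀ e₁ e₂ e₃
  rewrite e₃ | Σ<-+ (s ℕ.+ z) m h | Σ<-+ s z h
        | Σ<-cong s e₀ | Σ<-const s 0 | *-zeroʳ s
        | Σ<-cong z e₁ | Σ<-reverse z (λ k → tree d (suc m) (z ∸ k))
        | Σ<-cong m e₂ | Σ<-reverse m (λ i → tree d (suc (m ∸ i)) (suc i ℕ.+ z))
        | Σ<-cong z {λ k → tree d (suc m) (z ∸ (z ∸ suc k))} {λ r → tree d (suc m) (suc r)}
            (λ k k<z → cong (tree d (suc m)) (m∸[m∸n]≡n k<z))
        | Σ<-cong m {λ k → tree d (suc (m ∸ (m ∸ suc k))) (suc (m ∸ suc k) ℕ.+ z)}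
                    {λ k → tree d (2 ℕ.+ k) ((m ∸ k) ℕ.+ z)}
            (λ k k<m → cong₂ (λ a b → tree d (suc a) (b ℕ.+ z)) (m∸[m∸n]≡n k<m) (sym (+-∸-assoc 1 k<m)))
        | n∸n≡0 m
  = trans (cong (tree d (2 ℕ.+ m) z ℕ.+_) (+-comm (Σ< z _) (Σ< m _)))
          (sym (+-assoc (tree d (2 ℕ.+ m) z) (Σ< m _) (Σ< z _)))

-- For 2143: below `t` a site with `p`, preceded by r such sites, gives (x , r + 1). The site
-- `t + i` gives the child with k = m - i.
tree-rank : ∀ d t m p h →
  (∀ j → j < t → h j ≡ (if p j then tree d (suc m) (suc (rank p j)) else 0)) →
  (∀ i → i ≤ m → h (t ℕ.+ i) ≡ tree d (suc (suc m ∸ i)) (i ℕ.+ rank p t)) →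
  Σ< (t ℕ.+ suc m) h ≡ tree (suc d) (suc m) (rank p t)
tree-rank d t m p h e₁ e₂
  rewrite Σ<-+ t (suc m) h | Σ<-cong t e₁ | Σ<-rank t p (λ r → tree d (suc m) (suc r))
        | Σ<-cong (suc m) (λ i i≤m → e₂ i (s≤s⁻¹ i≤m))
        | Σ<-reverse (suc m) (λ i → tree d (suc (suc m ∸ i)) (i ℕ.+ rank p t))
        | Σ<-cong (suc m) {λ k → tree d (suc (suc m ∸ (m ∸ k))) ((m ∸ k) ℕ.+ rank p t)}
                          {λ k → tree d (2 ℕ.+ k) ((m ∸ k) ℕ.+ rank p t)}
            (λ k k≤m → cong (λ a → tree d (suc a) ((m ∸ k) ℕ.+ rank p t)) (m∸[m∸n]≡n k≤m))
  = +-comm (Σ< (rank p t) _) _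

-- Invariance under order-preserving relabelling

<ᵇ-cong : ∀ {a b c d} → (a < b ⇔ c < d) → (a <ᵇ b) ≡ (c <ᵇ d)
<ᵇ-cong {a} {b} {c} {d} e = bool-ext (mk⇔ (<⇒<ᵇ ∘ to e ∘ <ᵇ⇒< a b) (<⇒<ᵇ ∘ from e ∘ <ᵇ⇒< c d))

-- The statistics are built from comparisons, maxima and the default 0, all of which a strictly
-- monotone `f` fixing 0 respects.
module Relabel {f : ℕ → ℕ} (f< : StrictlyMonotone f) (f-0 : f 0 ≡ 0) where

  reflects-< : ∀ {a b} → f a < f b ⇔ a < b
  reflects-< {a} {b} = mk⇔ ⇒ f<
    where
    ⇒ : f a < f b → a < b
    ⇒ fa<fb with <-cmp a b
    ... | tri< a<b _ _  = a<b
    ... | tri≈ _ refl _ = ⊥-elim (<-irrefl refl fa<fb)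
    ... | tri> _ _ b<a  = ⊥-elim (<-asym fa<fb (f< b<a))

  mono-≤ : ∀ {a b} → a ≤ b → f a ≤ f b
  mono-≤ a≤b = ≮⇒≥ (λ fb<fa → <⇒≱ (to reflects-< fb<fa) a≤b)

  distrib-⊔ : ∀ a b → f (a ⊔ b) ≡ f a ⊔ f b
  distrib-⊔ = mono-≤-distrib-⊔ mono-≤

  distrib-if : ∀ b a → (if b then f a else 0) ≡ f (if b then a else 0)
  distrib-if true  a = refl
  distrib-if false a = sym f-0

  top-map : ∀ k w → top k (map f w) ≡ f (top k w)
  top-map zero    []      = sym f-0
  top-map (suc k) []      = sym f-0
  top-map zero    (v ∷ w) = trans (cong (f v ⊔_) (top-map zero w)) (sym (distrib-⊔ v _))
  top-map (suc k) (v ∷ w)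
    rewrite top-map k w | top-map (suc k) w | <ᵇ-cong (reflects-< {v} {top k w})
          | distrib-if (v <ᵇ top k w) v = sym (distrib-⊔ _ _)

  below-map : ∀ d w → below (f d) (map f w) ≡ f (below d w)
  below-map d []      = sym f-0
  below-map d (c ∷ w)
    rewrite below-map d w | <ᵇ-cong (reflects-< {c} {d}) | distrib-if (c <ᵇ d) c = sym (distrib-⊔ _ _)

  bottom-map : ∀ w → bottom (map f w) ≡ f (bottom w)
  bottom-map []      = sym f-0
  bottom-map (d ∷ w) rewrite below-map d w | bottom-map w = sym (distrib-⊔ _ _)

  -- Only comparisons with the bounds are assumed to correspond, since a bound may lie outside the
  -- image of `f`: `shift j` misses the new entry `suc j`.
  split-map : ∀ {lo lo′ hi hi′} → (∀ a → f a < lo′ ⇔ a < lo) → (∀ c → hi′ < f c ⇔ hi < c) →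
              ∀ w → split lo′ hi′ (map f w) ≡ split lo hi w
  split-map l h []      = refl
  split-map l h (a ∷ w)
    rewrite bottom-map w | <ᵇ-cong (l a) | <ᵇ-cong (h (bottom w)) = cong (_ ∨_) (split-map l h w)

  has2143-map : ∀ w → has2143 (map f w) ≡ has2143 w
  has2143-map []      = refl
  has2143-map (b ∷ w) =
    cong₂ _∨_ (split-map (λ _ → reflects-<) (λ _ → reflects-<) w) (has2143-map w)

module Shift (j : ℕ) = Relabel (shift-mono j) (shift-low {j} z≤n)

-- Generating tree of the 1234-avoiders

suc<shift⇔ : ∀ {j v} → suc j < shift j v ⇔ j < v
suc<shift⇔ {j} {v} = mk⇔ ⇒ ⇐
  where
  ⇒ : suc j < shift j v → j < v
  ⇒ s< with shiftView j v
  ... | low v≤j e  = ⊥-elim (<⇒≱ (subst (suc j <_) e s<) (m≤n⇒m≤1+n v≤j))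
  ... | high j<v _ = j<v
  ⇐ : j < v → suc j < shift j v
  ⇐ j<v = subst (suc j <_) (sym (shift-high j<v)) (s<s j<v)

-- The first term is the chain started by the new entry, the second the best chain in the shifted
-- tail.
top-cons : ∀ k j w → top (suc k) (cons j w) ≡ (if j <ᵇ top k w then suc j else 0) ⊔ shift j (top (suc k) w)
top-cons k j w rewrite Shift.top-map j k w | Shift.top-map j (suc k) w | <ᵇ-cong (suc<shift⇔ {j} {top k w}) = refl

top-cons-< : ∀ {k j w} → j < top k w → top (suc k) (cons j w) ≡ suc j ⊔ shift j (top (suc k) w)
top-cons-< {k} {j} {w} j<t rewrite top-cons k j w | <⇒<ᵇ≡true j<t = refl

top-cons-≥ : ∀ {k j w} → top k w ≤ j → top (suc k) (cons j w) ≡ shift j (top (suc k) w)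
top-cons-≥ {k} {j} {w} t≤j rewrite top-cons k j w | ≤⇒<ᵇ≡false t≤j = refl

-- At level 0 a chain is a single entry, so `top 0` is the maximum.
top-perm : ∀ {n w} → IsPerm n w → top 0 w ≡ n
top-perm {zero}  {[]} p = refl
top-perm {suc n} p with j , w , j≤n , q , refl ← cons-perm⁻ p
  rewrite Shift.top-map j 0 w | top-perm q with shiftView j n
... | high j<n e rewrite e = m≤n⇒m⊔n≡n (s≤s (<⇒≤ j<n))
... | low n≤j e rewrite e | ≤-antisym j≤n n≤j = m≥n⇒m⊔n≡m (n≤1+n n)

if-≤ : ∀ b v → (if b then v else 0) ≤ v
if-≤ true  v = ≤-refl
if-≤ false v = z≤n

-- A chain keeps its first entry when its last one is dropped.
top-anti : ∀ k w → top (suc k) w ≤ top k w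
top-anti zero    []      = z≤n
top-anti (suc k) []      = z≤n
top-anti zero    (v ∷ w) = ⊔-mono-≤ (if-≤ _ v) (top-anti zero w)
top-anti (suc k) (v ∷ w) = ⊔-mono-≤ lemma (top-anti (suc k) w)
  where
  lemma : (if v <ᵇ top (suc k) w then v else 0) ≤ (if v <ᵇ top k w then v else 0)
  lemma with v <ᵇ top (suc k) w in eq
  ... | false = z≤n
  ... | true rewrite <⇒<ᵇ≡true (<-≤-trans (<ᵇ⇒< v _ (from T-≡ eq)) (top-anti k w)) = ≤-refl

-- The sites from `top 1 w` to `length w` start no 123; those from `top 2 w` up to but excluding
-- `top 1 w` start a 123 but no 1234.
module L1234 = Labelling (λ w → top 3 w ≡ᵇ 0)
  (λ w → suc (length w ∸ top 1 w)) (λ w → top 1 w ∸ top 2 w) refl refl refl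

weight-1234 : ∀ d {n j a b w} → IsPerm n w →
  top 1 (cons j w) ≡ a → top 2 (cons j w) ≡ b → top 3 (cons j w) ≡ 0 →
  L1234.weight d (cons j w) ≡ tree d (suc (suc n ∸ a)) (a ∸ b)
weight-1234 d {j = j} {w = w} p e₁ e₂ e₃ rewrite e₃ | e₁ | e₂ | length-map (shift j) w | len p = refl

step-1234 : ∀ d {n w} → IsPerm n w → Σ< (suc n) (λ j → L1234.weight d (cons j w)) ≡ L1234.weight (suc d) w
step-1234 d {n} {w} p with top 3 w in eq₃
-- The parent contains 1234, hence so does every child.
... | suc t = trans (Σ<-cong (suc n) {g = λ _ → 0} zeros) (trans (Σ<-const (suc n) 0) (*-zeroʳ n))
  where
  zeros : ∀ j → j < suc n → L1234.weight d (cons j w) ≡ 0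
  zeros j _ rewrite top-cons 2 j w | eq₃ | proj₂ (shift-suc j t)
    with (if j <ᵇ top 2 w then suc j else 0)
  ... | zero  = refl
  ... | suc _ = refl
-- The sites 0 to `n` are cut at `s`, at `s + z = t` and at the last one, `s + z + m = n`.
... | zero with z , s+z≡t ← m≤n⇒∃[o]m+o≡n (top-anti 1 w)
           with m , t+m≡n ← m≤n⇒∃[o]m+o≡n (top-anti 0 w)
           rewrite top-perm p | len p = begin
  Σ< (suc n) h                                ≡⟨ cong (λ a → Σ< (suc a) h) n≡ ⟨
  Σ< (suc (s ℕ.+ z ℕ.+ m)) h                  ≡⟨ tree-interval d s z m h e₀ e₁ e₂ e₃ ⟩
  tree (suc d) (suc m) z                      ≡⟨ cong₂ (λ a b → tree (suc d) (suc a) b) n∸t t∸s ⟨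
  tree (suc d) (suc (n ∸ t)) (t ∸ s)          ∎
  where
  open ≡-Reasoning
  s = top 2 w
  t = top 1 w
  h = λ j → L1234.weight d (cons j w)
  n≡ : s ℕ.+ z ℕ.+ m ≡ n
  n≡ = trans (cong (ℕ._+ m) s+z≡t) t+m≡n
  n∸t : n ∸ t ≡ m
  n∸t = trans (cong (_∸ t) (sym t+m≡n)) (m+n∸m≡n t m)
  t∸s : t ∸ s ≡ z
  t∸s = trans (cong (_∸ s) (sym s+z≡t)) (m+n∸m≡n s z)
  s≤t : s ≤ t
  s≤t = top-anti 1 w
  t≤n : t ≤ n
  t≤n = ≤-trans (top-anti 0 w) (≤-reflexive (top-perm p))
  top₁-< : ∀ {j} → j < n → top 1 (cons j w) ≡ suc j ⊔ shift j t
  top₁-< j<n = top-cons-< {0} {w = w} (<-≤-trans j<n (≤-reflexive (sym (top-perm p))))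
  top₃-0 : ∀ {j} → s ≤ j → top 3 (cons j w) ≡ 0
  top₃-0 {j} s≤j = trans (top-cons-≥ {2} {w = w} s≤j) (trans (cong (shift j) eq₃) (shift-low {j} z≤n))
  e₀ : ∀ j → j < s → h j ≡ 0
  e₀ j j<s rewrite top-cons-< {2} {w = w} j<s | eq₃ | shift-low {j} z≤n = refl
  -- The new entry starts a 123 and becomes the value of `top 2`; `top 1` is only shifted, to
  -- `suc t`.
  e₁ : ∀ k → k < z → h (s ℕ.+ k) ≡ tree d (suc m) (z ∸ k)
  e₁ k k<z = trans
    (weight-1234 d p
      (trans (top₁-< (<-≤-trans j<t t≤n)) (trans (cong (suc j ⊔_) (shift-high j<t)) (m≤n⇒m⊔n≡n (<⇒≤ (s<s j<t)))))
      (trans (top-cons-< {1} {w = w} j<t)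
        (trans (cong (suc j ⊔_) (shift-low s≤j)) (m≥n⇒m⊔n≡m (m≤n⇒m≤1+n s≤j))))
      (top₃-0 s≤j))
    (cong₂ (λ a b → tree d (suc a) b) n∸t
      (trans (cong (_∸ j) (sym s+z≡t)) ([m+n]∸[m+o]≡n∸o s z k)))
    where
    j = s ℕ.+ k
    s≤j : s ≤ j
    s≤j = m≤m+n s k
    j<t : j < t
    j<t = <-≤-trans (+-monoʳ-< s k<z) (≤-reflexive s+z≡t)
  -- The new entry starts an ascent but no 123: it becomes the value of `top 1`, and `top 2` stays.
  e₂ : ∀ i → i < m → h (s ℕ.+ z ℕ.+ i) ≡ tree d (suc (m ∸ i)) (suc i ℕ.+ z)
  e₂ i i<m = trans
    (weight-1234 d p
      (trans (top₁-< j<n) (trans (cong (suc j ⊔_) (shift-low t≤j)) (m≥n⇒m⊔n≡m (m≤n⇒m≤1+n t≤j))))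
      (trans (top-cons-≥ {1} {w = w} t≤j) (shift-low (≤-trans s≤t t≤j)))
      (top₃-0 (≤-trans s≤t t≤j)))
    (cong₂ (λ a b → tree d (suc a) b)
      (trans (cong (_∸ j) (sym n≡)) ([m+n]∸[m+o]≡n∸o (s ℕ.+ z) m i))
      (begin
        suc j ∸ s                     ≡⟨ cong (λ a → suc a ∸ s) (+-assoc s z i) ⟩
        suc (s ℕ.+ (z ℕ.+ i)) ∸ s     ≡⟨ cong (_∸ s) (+-suc s (z ℕ.+ i)) ⟨
        s ℕ.+ suc (z ℕ.+ i) ∸ s       ≡⟨ m+n∸m≡n s _ ⟩
        suc (z ℕ.+ i)                 ≡⟨ cong suc (+-comm z i) ⟩
        suc i ℕ.+ z                   ∎))
    where
    j = s ℕ.+ z ℕ.+ i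
    t≤j : t ≤ j
    t≤j = ≤-trans (≤-reflexive (sym s+z≡t)) (m≤m+n (s ℕ.+ z) i)
    j<n : j < n
    j<n = <-≤-trans (+-monoʳ-< (s ℕ.+ z) i<m) (≤-reflexive n≡)
  -- A new maximum in front starts no ascent: `top 1` and `top 2` stay while the length grows.
  e₃ : h (s ℕ.+ z ℕ.+ m) ≡ tree d (2 ℕ.+ m) z
  e₃ rewrite n≡ = trans
    (weight-1234 d p
      (trans (top-cons-≥ {0} {w = w} (≤-reflexive (top-perm p))) (shift-low t≤n))
      (trans (top-cons-≥ {1} {w = w} t≤n) (shift-low (≤-trans s≤t t≤n)))
      (top₃-0 (≤-trans s≤t t≤n)))
    (cong₂ (λ a b → tree d (suc a) b) (trans (+-∸-assoc 1 t≤n) (cong suc n∸t)) t∸s)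

E-tree : ∀ n → E n ≡ tree n 1 0
E-tree n = trans (count-cong (λ w∈ → avoids-1234 (All.map proj₁ (bounds (to (∈-perms n) w∈)))))
                 (L1234.count-tree step-1234 n)

-- Generating tree of the 2143-avoiders

-- Entries moved by `shift j` lie above `j`, hence above `e`, before and after the move. The same
-- holds for `<shift⇔`.
shift<suc⇔ : ∀ {e j} → e ≤ j → ∀ a → shift j a < suc e ⇔ a < suc e
shift<suc⇔ {e} {j} e≤j a with shiftView j a
... | low _ eq rewrite eq = mk⇔ (λ q → q) (λ q → q)
... | high j<a eq rewrite eq =
  mk⇔ (<-trans (n<1+n a)) (λ a≤e → ⊥-elim (<⇒≱ j<a (≤-trans (s≤s⁻¹ a≤e) e≤j)))

<shift⇔ : ∀ {e j} → e ≤ j → ∀ c → e < shift j c ⇔ e < c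
<shift⇔ {e} {j} e≤j c with shiftView j c
... | low _ eq rewrite eq = mk⇔ (λ q → q) (λ q → q)
... | high j<c eq rewrite eq = mk⇔ (λ _ → ≤-<-trans e≤j j<c) m<n⇒m<1+n

-- Does cons e w have a 2143 starting with its first entry?
dead : List ℕ → ℕ → Bool
dead w e = split (suc e) e w

alive : List ℕ → ℕ → Bool
alive w e = not (dead w e)

-- Both bounds are `suc j` for the shifted tail; undoing the shift turns them into the `suc j` and
-- `j` of `dead`.
has2143-cons : ∀ j w → has2143 (cons j w) ≡ dead w j ∨ has2143 w
has2143-cons j w = cong₂ _∨_
  (Shift.split-map j (shift<suc⇔ ≤-refl) (λ _ → suc<shift⇔) w)
  (Shift.has2143-map j w)

-- The entry `suc j` is not below `suc e`, so it cannot play the 1.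
dead-cons : ∀ {e j} w → e ≤ j → dead (cons j w) e ≡ dead w e
dead-cons {e} {j} w e≤j rewrite ≤⇒<ᵇ≡false e≤j =
  Shift.split-map j (shift<suc⇔ e≤j) (<shift⇔ e≤j) w

-- The entry `suc j` is at most `e` and plays the 1, in front of an inversion above `e`.
dead-cons-high : ∀ {e j} w → j < e → e < shift j (bottom w) → dead (cons j w) e ≡ true
dead-cons-high {e} {j} w j<e e<b
  rewrite Shift.bottom-map j w | <⇒<ᵇ≡true j<e | <⇒<ᵇ≡true e<b = refl

dead⇒<bottom : ∀ w {e} → T (dead w e) → e < bottom w
dead⇒<bottom w {e} t with a , d , c , p , _ , q ← to (split⇔ (suc e) e w) t =
  from (<bottom⇔ w) (d , c , ⊆-trans (a ∷ʳ ⊆-refl) p , q)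

≥bottom⇒alive : ∀ w {e} → bottom w ≤ e → alive w e ≡ true
≥bottom⇒alive w b≤e = to T-≡ (from T-not (λ t → <⇒≱ (dead⇒<bottom w t) b≤e))

-- The shift leaves the entry `j` in place, and it is the largest one below `suc j`. For `j = 0` the
-- default value 0 is the right one.
below-perm : ∀ {n j w} → IsPerm n w → j ≤ n → below (suc j) (map (shift j) w) ≡ j
below-perm {n} {j} {w} p j≤n = ≤-antisym (≮⇒≥ upper) (lower j≤n)
  where
  w′ = map (shift j) w
  upper : ¬ (j < below (suc j) w′)
  upper j< with c , _ , j<c , c≤j ← to (<below⇔ (suc j) w′) j< = <⇒≱ j<c (s≤s⁻¹ c≤j)
  lower : ∀ {i} → i ≤ n → i ≤ below (suc i) (map (shift i) w)
  lower {zero}  _   = z≤n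
  lower {suc i} i<n = from (<below⇔ (2 ℕ.+ i) (map (shift (suc i)) w))
    ( suc i
    , subst (_∈ map (shift (suc i)) w) (shift-low ≤-refl) (∈-map⁺ (shift (suc i)) (perm-surjective p z<s i<n))
    , n<1+n i , n<1+n (suc i))

bottom-cons : ∀ {n j w} → IsPerm n w → j ≤ n → bottom (cons j w) ≡ j ⊔ shift j (bottom w)
bottom-cons {j = j} {w} p j≤n = cong₂ _⊔_ (below-perm p j≤n) (Shift.bottom-map j w)

bottom≤n : ∀ {n w} → IsPerm n w → bottom w ≤ n
bottom≤n {n} {w} p = ≮⇒≥ (λ n<b → let d , c , q , n<c , _ = to (<bottom⇔ w) n<b in
  <⇒≱ n<c (proj₂ (All.lookup (bounds p) (lookup q (there (here refl))))))

-- The bottom rises to `suc (bottom w)`. Sites up to `j` keep their status, and those above `j` die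
-- because the new entry plays the 1; the extra live site is `j` itself.
rank-cons-< : ∀ {j} w → j < bottom w → alive w j ≡ true →
              rank (alive (cons j w)) (suc (bottom w)) ≡ suc (rank (alive w) j)
rank-cons-< {j} w j<t alive-j = begin
  rank (alive (cons j w)) (suc t)                              ≡⟨ cong (rank (alive (cons j w)) ∘ suc) j+k≡t ⟨
  rank (alive (cons j w)) (suc j ℕ.+ k)                        ≡⟨ Σ<-+ (suc j) k _ ⟩
  rank (alive (cons j w)) (suc j) ℕ.+ Σ< k (λ i → indicator (alive (cons j w) (suc j ℕ.+ i)))
    ≡⟨ cong₂ ℕ._+_ (Σ<-cong (suc j) (λ e e≤j → cong (indicator ∘ not) (dead-cons w (s≤s⁻¹ e≤j))))
                   (Σ<-cong k (λ i i<k → cong (indicator ∘ not) (killed i i<k))) ⟩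
  rank (alive w) (suc j) ℕ.+ Σ< k (λ _ → 0)
    ≡⟨ cong₂ ℕ._+_ (cong (λ b → indicator b ℕ.+ rank (alive w) j) alive-j) (trans (Σ<-const k 0) (*-zeroʳ k)) ⟩
  suc (rank (alive w) j) ℕ.+ 0                                 ≡⟨ +-identityʳ _ ⟩
  suc (rank (alive w) j)                                       ∎
  where
  open ≡-Reasoning
  t = bottom w
  k = proj₁ (m≤n⇒∃[o]m+o≡n (<⇒≤ j<t))
  j+k≡t : j ℕ.+ k ≡ t
  j+k≡t = proj₂ (m≤n⇒∃[o]m+o≡n (<⇒≤ j<t))
  killed : ∀ i → i < k → dead (cons j w) (suc j ℕ.+ i) ≡ true
  killed i i<k = dead-cons-high w (s≤s (m≤m+n j i))
    (subst (suc j ℕ.+ i <_) (sym (shift-high j<t)) (s<s (<-≤-trans (+-monoʳ-< j i<k) (≤-reflexive j+k≡t))))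

-- The new entry forms an inversion with the value one below it, which raises the bottom to the site
-- used. The `i` sites passed over are all alive, and no status changes.
rank-cons-≥ : ∀ w i → rank (alive (cons (bottom w ℕ.+ i) w)) (bottom w ℕ.+ i) ≡ i ℕ.+ rank (alive w) (bottom w)
rank-cons-≥ w i = begin
  rank (alive (cons j w)) j                                    ≡⟨ Σ<-cong j (λ e e<j → cong (indicator ∘ not) (dead-cons w (<⇒≤ e<j))) ⟩
  rank (alive w) j                                             ≡⟨ Σ<-+ t i _ ⟩
  rank (alive w) t ℕ.+ Σ< i (λ k → indicator (alive w (t ℕ.+ k)))
    ≡⟨ cong (rank (alive w) t ℕ.+_) (Σ<-cong i (λ k _ → cong indicator (≥bottom⇒alive w (m≤m+n t k)))) ⟩
  rank (alive w) t ℕ.+ Σ< i (λ _ → 1)                          ≡⟨ cong (rank (alive w) t ℕ.+_) (trans (Σ<-const i 1) (*-identityʳ i)) ⟩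
  rank (alive w) t ℕ.+ i                                       ≡⟨ +-comm _ i ⟩
  i ℕ.+ rank (alive w) t                                       ∎
  where
  open ≡-Reasoning
  t = bottom w
  j = t ℕ.+ i

-- The sites from `bottom w` on start no 132. The live sites below it may be interspersed with dead
-- ones, so they are counted by `rank`.
module L2143 = Labelling (not ∘ has2143)
  (λ w → suc (length w ∸ bottom w)) (λ w → rank (alive w) (bottom w)) refl refl refl

weight-2143 : ∀ d {n j w} → IsPerm n w → j ≤ n → has2143 w ≡ false →
  L2143.weight d (cons j w) ≡
    (if alive w j then tree d (suc (suc n ∸ (j ⊔ shift j (bottom w)))) (rank (alive (cons j w)) (j ⊔ shift j (bottom w))) else 0)
weight-2143 d {j = j} {w = w} p j≤n a
  rewrite has2143-cons j w | a | bottom-cons p j≤n | length-map (shift j) w | len p | ∨-identityʳ (dead w j) = refl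

step-2143 : ∀ d {n w} → IsPerm n w → Σ< (suc n) (λ j → L2143.weight d (cons j w)) ≡ L2143.weight (suc d) w
step-2143 d {n} {w} p with has2143 w in eq
... | true = trans (Σ<-cong (suc n) {g = λ _ → 0} zeros) (trans (Σ<-const (suc n) 0) (*-zeroʳ n))
  where
  zeros : ∀ j → j < suc n → L2143.weight d (cons j w) ≡ 0
  zeros j _ rewrite has2143-cons j w | eq | ∨-zeroʳ (dead w j) = refl
... | false with m , t+m≡n ← m≤n⇒∃[o]m+o≡n (bottom≤n p) rewrite len p = begin
  Σ< (suc n) h                                  ≡⟨ cong (λ a → Σ< a h) (trans (+-suc t m) (cong suc t+m≡n)) ⟨
  Σ< (t ℕ.+ suc m) h                            ≡⟨ tree-rank d t m (alive w) h e₁ e₂ ⟩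
  tree (suc d) (suc m) (rank (alive w) t)       ≡⟨ cong (λ a → tree (suc d) (suc a) (rank (alive w) t)) n∸t ⟨
  tree (suc d) (suc (n ∸ t)) (rank (alive w) t) ∎
  where
  open ≡-Reasoning
  t = bottom w
  h = λ j → L2143.weight d (cons j w)
  n∸t : n ∸ t ≡ m
  n∸t = trans (cong (_∸ t) (sym t+m≡n)) (m+n∸m≡n t m)
  -- Length and bottom both grow by one, so the first label stays.
  e₁ : ∀ j → j < t → h j ≡ (if alive w j then tree d (suc m) (suc (rank (alive w) j)) else 0)
  e₁ j j<t
    rewrite weight-2143 d p (<⇒≤ (<-≤-trans j<t (bottom≤n p))) eq
          | shift-high j<t | m≤n⇒m⊔n≡n (m≤n⇒m≤1+n (<⇒≤ j<t)) | n∸t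
    with alive w j in alive-j
  ... | false = refl
  ... | true  = cong (tree d (suc m)) (rank-cons-< w j<t alive-j)
  e₂ : ∀ i → i ≤ m → h (t ℕ.+ i) ≡ tree d (suc (suc m ∸ i)) (i ℕ.+ rank (alive w) t)
  e₂ i i≤m
    rewrite weight-2143 d p (≤-trans (+-monoʳ-≤ t i≤m) (≤-reflexive t+m≡n)) eq
          | shift-low (m≤m+n t i) | m≥n⇒m⊔n≡m (m≤m+n t i)
          | ≥bottom⇒alive w (m≤m+n t i) | rank-cons-≥ w i
    = cong (λ a → tree d (suc a) (i ℕ.+ rank (alive w) t))
        (trans (cong (λ a → a ∸ (t ℕ.+ i)) (sym (trans (+-suc t m) (cong suc t+m≡n))))
               ([m+n]∸[m+o]≡n∸o t (suc m) i))

count-2143 : ∀ n → count (λ w → avoidsᵇ w p2143) (perms n) ≡ E n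
count-2143 n = trans (count-cong {xs = perms n} (λ {w} _ → avoids-2143 w))
  (trans (L2143.count-tree step-2143 n) (sym (E-tree n)))

-- Decomposable 2143-avoiders

unique-++⁻ : ∀ {A : Set} xs {ys : List A} → Unique (xs ++ ys) → Unique xs × (∀ {x} → x ∈ xs → x ∉ ys)
unique-++⁻ []       u        = [] , λ ()
unique-++⁻ {A} (x ∷ xs) {ys} (x≢ ∷ u) with ux , dis ← unique-++⁻ xs u | x≢xs , x≢ys ← All.++⁻ xs x≢ =
  x≢xs ∷ ux , λ { (here refl) x∈ys → All.lookup x≢ys x∈ys refl ; (there x∈xs) → dis x∈xs }

snoc-perm : ∀ {n w} → IsPerm n w → IsPerm (suc n) (w ++ [ suc n ])
snoc-perm {n} {w} (perm l b u) = perm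
  (trans (length-++ w) (trans (+-comm (length w) 1) (cong suc l)))
  (All.++⁺ (All.map (λ (0<v , v≤n) → 0<v , m≤n⇒m≤1+n v≤n) b) ((z<s , ≤-refl) ∷ []))
  (Unique.++⁺ u ([] ∷ []) (λ { (v∈w , here refl) → <⇒≱ (n<1+n n) (proj₂ (All.lookup b v∈w)) }))

snoc-perm⁻ : ∀ {n w} → IsPerm (suc n) (w ++ [ suc n ]) → IsPerm n w
snoc-perm⁻ {n} {w} (perm l b u) with uw , dis ← unique-++⁻ w u | bw , _ ← All.++⁻ w b = perm
  (suc-injective (trans (sym (trans (length-++ w) (+-comm (length w) 1))) l))
  (All.tabulate (λ v∈w → let 0<v , v≤1+n = All.lookup bw v∈w in
    0<v , s≤s⁻¹ (≤∧≢⇒< v≤1+n (λ { refl → dis v∈w (here refl) }))))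
  uw

startsᵇ : List ℕ → Bool
startsᵇ []      = false
startsᵇ (x ∷ _) = x ≡ᵇ 1

endsᵇ : ℕ → List ℕ → Bool
endsᵇ m []          = false
endsᵇ m (x ∷ [])    = x ≡ᵇ m
endsᵇ m (_ ∷ y ∷ w) = endsᵇ m (y ∷ w)

endsᵇ⇔ : ∀ m w → T (endsᵇ m w) ⇔ (∃ λ v → w ≡ v ++ [ m ])
endsᵇ⇔ m w = mk⇔ (⇒ w) (λ (v , e) → subst (T ∘ endsᵇ m) (sym e) (⇐ v))
  where
  ⇒ : ∀ w → T (endsᵇ m w) → ∃ λ v → w ≡ v ++ [ m ]
  ⇒ (x ∷ [])    t = [] , cong [_] (≡ᵇ⇒≡ x m t)
  ⇒ (x ∷ y ∷ w) t with v , e ← ⇒ (y ∷ w) t = x ∷ v , cong (x ∷_) e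
  ⇐ : ∀ v → T (endsᵇ m (v ++ [ m ]))
  ⇐ []          = ≡⇒≡ᵇ m m refl
  ⇐ (x ∷ [])    = ⇐ []
  ⇐ (x ∷ y ∷ v) = ⇐ (y ∷ v)

endsᵇ-++ : ∀ {m} v u → T (endsᵇ m u) → T (endsᵇ m (v ++ u))
endsᵇ-++ {m} v u t with u′ , refl ← to (endsᵇ⇔ m u) t =
  from (endsᵇ⇔ m (v ++ u)) (v ++ u′ , sym (++-assoc v u′ [ m ]))

IsInitial : List ℕ → ℕ → Set
IsInitial w i = All (λ x → 0 < x × x ≤ i) (take i w) × (∀ {j} → 0 < j → j ≤ i → j ∈ take i w)

prefixIsInitial⇔ : ∀ w i → T (prefixIsInitial w i) ⇔ IsInitial w i
prefixIsInitial⇔ w i = mk⇔ ⇒ ⇐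
  where
  ⇒ : T (prefixIsInitial w i) → IsInitial w i
  ⇒ t with a , b ← to T-∧ t =
    All.map (λ {x} m → to (∈-range1 i) (to (memᵇ⇔∈ x (range1 i)) m)) (All.all⁺ _ (take i w) a) ,
    λ {j} 0<j j≤i → to (memᵇ⇔∈ j (take i w)) (All.lookup (All.all⁺ _ (range1 i) b) (from (∈-range1 i) (0<j , j≤i)))
  ⇐ : IsInitial w i → T (prefixIsInitial w i)
  ⇐ (a , b) = from T-∧
    ( All.all⁻ _ (All.map (λ {x} m → from (memᵇ⇔∈ x (range1 i)) (from (∈-range1 i) m)) a)
    , All.all⁻ _ (All.tabulate (λ {j} j∈ → let 0<j , j≤i = to (∈-range1 i) j∈ in
        from (memᵇ⇔∈ j (take i w)) (b 0<j j≤i))))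

take-length : ∀ (v u : List ℕ) → take (length v) (v ++ u) ≡ v
take-length []      u = refl
take-length (x ∷ v) u = cong (x ∷_) (take-length v u)

perm-initial : ∀ {n} v u → IsPerm n v → IsInitial (v ++ u) n
perm-initial v u p@(perm refl b _) rewrite take-length v u = b , perm-surjective p

indecomposableᵇ⇔ : ∀ {n w} → IsPerm (suc n) w →
  T (indecomposableᵇ w) ⇔ (∀ {i} → 0 < i → i ≤ n → ¬ IsInitial w i)
indecomposableᵇ⇔ {n} {w@(x ∷ v)} p@(perm refl b _) = mk⇔ ⇒ ⇐
  where
  ⇒ : T (indecomposableᵇ w) → ∀ {i} → 0 < i → i ≤ n → ¬ IsInitial w i
  ⇒ t {i} 0<i i≤n init =
    to T-not (All.lookup (All.all⁺ _ (range1 n) (proj₁ (to T-∧ t))) (from (∈-range1 n) (0<i , i≤n)))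
      (from (prefixIsInitial⇔ w i) init)
  ⇐ : (∀ {i} → 0 < i → i ≤ n → ¬ IsInitial w i) → T (indecomposableᵇ w)
  ⇐ f = from T-∧
    ( All.all⁻ _ (All.tabulate (λ {i} i∈ → let 0<i , i≤n = to (∈-range1 n) i∈ in
        from T-not (f 0<i i≤n ∘ to (prefixIsInitial⇔ w i))))
    , from (prefixIsInitial⇔ w (suc n)) (subst (λ u → IsInitial u (suc n)) (++-identityʳ w) (perm-initial w [] p)))

-- The last entry serves as `c`.
inversion-from-max : ∀ {n} u → n ∈ u → ¬ T (endsᵇ n u) → ∃ λ c → n ∷ c ∷ [] ⊆ u × c ≢ n
inversion-from-max {n} u n∈u ¬e with initLast u
... | v ∷ʳ′ c with ∈-++⁻ v n∈u
...   | inj₂ (here refl) = ⊥-elim (¬e (from (endsᵇ⇔ n u) (v , refl)))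
...   | inj₁ n∈v = c , Sublist.++⁺ (from∈ n∈v) ⊆-refl , λ { refl → ¬e (from (endsᵇ⇔ c u) (v , refl)) }

-- If a prefix of w is initial, then b = the first entry, a = 1 in the prefix and
-- d = the maximum, c = the last entry outside of it form a 2143 pattern b a d c.
initial⇒has2143 : ∀ {n w i} → IsPerm (suc n) w → 0 < i → i ≤ n → IsInitial w i →
  ¬ T (startsᵇ w) → ¬ T (endsᵇ (suc n) w) → T (has2143 w)
initial⇒has2143 {n} {w@(x ∷ v)} {i@(suc i′)} p 0<i i≤n (small@((0<x , x≤i) ∷ _) , all) ¬s ¬e
  with ∈-++⁻ (take i w) (subst (suc n ∈_) (sym (take++drop≡id i w)) (perm-surjective p z<s ≤-refl))
... | inj₁ N∈ = ⊥-elim (<⇒≱ (s≤s i≤n) (proj₂ (All.lookup small N∈)))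
... | inj₂ N∈ with c , Nc⊆ , c≢N ← inversion-from-max (drop i w) N∈
                   (¬e ∘ subst (T ∘ endsᵇ (suc n)) (take++drop≡id i w) ∘ endsᵇ-++ (take i w) (drop i w))
              | _ , dis ← unique-++⁻ (take i w) (subst Unique (sym (take++drop≡id i w)) (unique p))
  = from (has2143⇔ w) (x , 1 , suc n , c
      , subst (x ∷ 1 ∷ suc n ∷ c ∷ [] ⊆_) (take++drop≡id i w) (Sublist.++⁺ x1⊆ Nc⊆)
      , ≤∧≢⇒< 0<x (¬s ∘ ≡⇒≡ᵇ x 1 ∘ sym)
      , ≤-<-trans x≤i (≰⇒> (λ c≤i → dis (all 0<c c≤i) c∈))
      , ≤∧≢⇒< c≤N c≢N)
  where
  x1⊆ : x ∷ 1 ∷ [] ⊆ take i w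
  x1⊆ with all z<s 0<i
  ... | here 1≡x = ⊥-elim (¬s (≡⇒≡ᵇ x 1 (sym 1≡x)))
  ... | there 1∈ = refl ∷ from∈ 1∈
  c∈ : c ∈ drop i w
  c∈ = lookup Nc⊆ (there (here refl))
  c-bounds : 0 < c × c ≤ suc n
  c-bounds = All.lookup (bounds p) (subst (c ∈_) (take++drop≡id i w) (∈-++⁺ʳ (take i w) c∈))
  0<c = proj₁ c-bounds
  c≤N = proj₂ c-bounds

-- Length at least 2 makes a prefix consisting of 1, or of all entries before a final maximum,
-- proper. The converse is `initial⇒has2143`.
indecomposable-2143 : ∀ {n w} → IsPerm (2 ℕ.+ n) w → has2143 w ≡ false →
  indecomposableᵇ w ≡ not (startsᵇ w ∨ endsᵇ (2 ℕ.+ n) w)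
indecomposable-2143 {n} {w} p avoids = bool-ext (mk⇔ ⇒ ⇐)
  where
  ⇒ : T (indecomposableᵇ w) → T (not (startsᵇ w ∨ endsᵇ (2 ℕ.+ n) w))
  ⇒ t = from T-not (λ se → decompose (to T-∨ se))
    where
    none = to (indecomposableᵇ⇔ p) t
    decompose : ¬ (T (startsᵇ w) ⊎ T (endsᵇ (2 ℕ.+ n) w))
    decompose (inj₁ s) = starts w s refl
      where
      starts : ∀ v → T (startsᵇ v) → ¬ (v ≡ w)
      starts (x ∷ v) s refl with refl ← ≡ᵇ⇒≡ x 1 s =
        none z<s (s≤s z≤n) (perm-initial [ 1 ] v (perm refl ((z<s , ≤-refl) ∷ []) ([] ∷ [])))
    decompose (inj₂ e) with v , refl ← to (endsᵇ⇔ (2 ℕ.+ n) w) e =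
      none z<s ≤-refl (perm-initial v [ 2 ℕ.+ n ] (snoc-perm⁻ p))
  ⇐ : T (not (startsᵇ w ∨ endsᵇ (2 ℕ.+ n) w)) → T (indecomposableᵇ w)
  ⇐ t = from (indecomposableᵇ⇔ p) (λ 0<i i≤n init → subst T avoids
    (initial⇒has2143 p 0<i i≤n init (to T-not t ∘ from T-∨ ∘ inj₁) (to T-not t ∘ from T-∨ ∘ inj₂)))

-- Here `g` is a bijection from the permutations of [m] to the permutations of [n] satisfying `p`,
-- and it carries `r` to `q`.
count-image : ∀ {m n} p q r (g : List ℕ → List ℕ) → (∀ {v w} → g v ≡ g w → v ≡ w) →
  (∀ {w} → IsPerm m w → IsPerm n (g w) × T (p (g w)) × q (g w) ≡ r w) →
  (∀ {w} → IsPerm n w → T (p w) → ∃ λ v → IsPerm m v × w ≡ g v) →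
  count (λ w → p w ∧ q w) (perms n) ≡ count r (perms m)
count-image {m} {n} p q r g inj into onto = begin
  count (λ w → p w ∧ q w) (perms n)                   ≡⟨ count-∧ (perms n) ⟩
  count q (filterᵇ p (perms n))                       ≡⟨ count-sum q (filterᵇ p (perms n)) ⟩
  sumOver (filterᵇ p (perms n)) (indicator ∘ q)       ≡⟨ sumOver-↭ (indicator ∘ q) image ⟩
  sumOver (map g (perms m)) (indicator ∘ q)           ≡⟨ sumOver-map g (perms m) (indicator ∘ q) ⟩
  sumOver (perms m) (indicator ∘ q ∘ g)
    ≡⟨ sumOver-cong (perms m) (λ w∈ → cong indicator (proj₂ (proj₂ (into (to (∈-perms m) w∈))))) ⟩
  sumOver (perms m) (indicator ∘ r)                   ≡⟨ count-sum r (perms m) ⟨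
  count r (perms m)                                   ∎
  where
  open ≡-Reasoning
  count-∧ : ∀ xs → count (λ w → p w ∧ q w) xs ≡ count q (filterᵇ p xs)
  count-∧ []       = refl
  count-∧ (x ∷ xs) with p x
  ... | false = count-∧ xs
  ... | true with q x
  ...   | true  = cong suc (count-∧ xs)
  ...   | false = count-∧ xs
  ⇒ : ∀ {w} → w ∈ filterᵇ p (perms n) → w ∈ map g (perms m)
  ⇒ w∈ with w∈′ , pw ← ∈-filter⁻ (T? ∘ p) {xs = perms n} w∈
       with v , pv , refl ← onto (to (∈-perms n) w∈′) pw = ∈-map⁺ g (from (∈-perms m) pv)
  ⇐ : ∀ {w} → w ∈ map g (perms m) → w ∈ filterᵇ p (perms n)
  ⇐ w∈ with v , v∈ , refl ← ∈-map⁻ g w∈ with perm-gv , pgv , _ ← into (to (∈-perms m) v∈) =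
    ∈-filter⁺ (T? ∘ p) (from (∈-perms n) perm-gv) pgv
  image : filterᵇ p (perms n) ↭ map g (perms m)
  image = unique-↭ (Unique.filter⁺ (T? ∘ p) (perms-unique n)) (Unique.map⁺ inj (perms-unique m)) (mk⇔ ⇒ ⇐)

-- Deleting a leading 1 or a final maximum

count-starts : ∀ m q r → (∀ {w} → IsPerm m w → q (cons 0 w) ≡ r w) →
  count (λ w → startsᵇ w ∧ q w) (perms (suc m)) ≡ count r (perms m)
count-starts m q r e = count-image startsᵇ q r (cons 0) (λ {v} {w} → proj₂ ∘ cons-injective {v = v} {w = w})
  (λ {w} p → cons-perm z≤n p , _ , e {w} p) onto
  where
  onto : ∀ {w} → IsPerm (suc m) w → T (startsᵇ w) → ∃ λ v → IsPerm m v × w ≡ cons 0 v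
  onto p s with zero , v , _ , q , refl ← cons-perm⁻ p = v , q , refl

count-ends : ∀ m q r → (∀ {w} → IsPerm m w → q (w ++ [ suc m ]) ≡ r w) →
  count (λ w → endsᵇ (suc m) w ∧ q w) (perms (suc m)) ≡ count r (perms m)
count-ends m q r e = count-image (endsᵇ (suc m)) q r (_++ [ suc m ]) (λ {v} {w} → ++-cancelʳ [ suc m ] v w)
  (λ {w} p → snoc-perm p , from (endsᵇ⇔ (suc m) (w ++ [ suc m ])) (w , refl) , e {w} p) onto
  where
  onto : ∀ {w} → IsPerm (suc m) w → T (endsᵇ (suc m) w) → ∃ λ v → IsPerm m v × w ≡ v ++ [ suc m ]
  onto {w} p t with v , refl ← to (endsᵇ⇔ (suc m) w) t = v , snoc-perm⁻ p , refl

split-positive : ∀ {hi w} → All (0 <_) w → split 1 hi w ≡ false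
split-positive []           = refl
split-positive {hi} {a ∷ w} (0<a ∷ pos) rewrite ≤⇒<ᵇ≡false 0<a = split-positive pos

-- A leading 1 cannot play the 2, as no entry is smaller.
has2143-cons-0 : ∀ {n w} → IsPerm n w → has2143 (cons 0 w) ≡ has2143 w
has2143-cons-0 {w = w} p = trans (has2143-cons 0 w)
  (cong (_∨ has2143 w) (split-positive (All.map proj₁ (bounds p))))

below-snoc : ∀ {d m} w → d ≤ m → below d (w ++ [ m ]) ≡ below d w
below-snoc []      d≤m rewrite ≤⇒<ᵇ≡false d≤m = refl
below-snoc (c ∷ w) d≤m = cong (_ ⊔_) (below-snoc w d≤m)

bottom-snoc : ∀ {m w} → All (_≤ m) w → bottom (w ++ [ m ]) ≡ bottom w
bottom-snoc []          = refl
bottom-snoc {w = _ ∷ w} (v≤m ∷ w≤m) = cong₂ _⊔_ (below-snoc w v≤m) (bottom-snoc w≤m)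

split-snoc : ∀ {lo hi m w} → All (_≤ m) w → split lo hi (w ++ [ m ]) ≡ split lo hi w
split-snoc {lo} {m = m} [] rewrite ∧-zeroʳ (m <ᵇ lo) = refl
split-snoc (_ ∷ w≤m) rewrite bottom-snoc w≤m = cong (_ ∨_) (split-snoc w≤m)

-- A final maximum could only play the 3, but no larger entry precedes it.
has2143-snoc : ∀ {m w} → All (_≤ m) w → has2143 (w ++ [ m ]) ≡ has2143 w
has2143-snoc []        = refl
has2143-snoc (_ ∷ w≤m) = cong₂ _∨_ (split-snoc w≤m) (has2143-snoc w≤m)

entries≤suc : ∀ {n w} → IsPerm n w → All (_≤ suc n) w
entries≤suc p = All.map (m≤n⇒m≤1+n ∘ proj₂) (bounds p)

des-map : ∀ {f} → (∀ {a b} → f a < f b ⇔ a < b) → ∀ w → des (map f w) ≡ des w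
des-map f< []          = refl
des-map f< (_ ∷ [])    = refl
des-map f< (a ∷ b ∷ w) =
  cong₂ (λ c k → (if c then 1 else 0) ℕ.+ k) (<ᵇ-cong (f< {b} {a})) (des-map f< (b ∷ w))

des-cons-0 : ∀ {n w} → IsPerm n w → des (cons 0 w) ≡ des w
des-cons-0 {w = []}        p = refl
des-cons-0 {w = suc v ∷ w} p = des-map (Shift.reflects-< 0) (suc v ∷ w)
des-cons-0 {w = zero ∷ w}  p with () ← proj₁ (All.head (bounds p))

des-snoc : ∀ {m w} → All (_≤ m) w → des (w ++ [ m ]) ≡ des w
des-snoc []                    = refl
des-snoc (v≤m ∷ []) rewrite ≤⇒<ᵇ≡false v≤m = refl
des-snoc {w = a ∷ b ∷ w} (_ ∷ w≤m) = cong (_ ℕ.+_) (des-snoc w≤m)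

-- Inclusion-exclusion: a 2143-avoider is decomposable iff it starts with 1 or ends with its
-- maximum, and deleting either entry preserves r.
count-indecomposable : (r : List ℕ → Bool) →
  (∀ {m w} → IsPerm m w → r (cons 0 w) ≡ r w) →
  (∀ {m w} → IsPerm m w → r (w ++ [ suc m ]) ≡ r w) → ∀ n →
  let A = λ m → count (λ w → avoidsᵇ w p2143 ∧ r w) (perms m) in
  A (2 ℕ.+ n) ℕ.+ A n ≡
    count (λ w → avoidsᵇ w p2143 ∧ (indecomposableᵇ w ∧ r w)) (perms (2 ℕ.+ n)) ℕ.+ (A (suc n) ℕ.+ A (suc n))
count-indecomposable r r-cons r-snoc n = begin
  A N ℕ.+ A n                              ≡⟨ cong₂ ℕ._+_ (count-sum (a∧ r) ps) (trans (sym count-se) (count-sum se ps)) ⟩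
  sumOver ps (indicator ∘ a∧ r) ℕ.+ sumOver ps (indicator ∘ se)    ≡⟨ sumOver-+ ps (indicator ∘ a∧ r) (indicator ∘ se) ⟨
  sumOver ps (λ w → indicator (a∧ r w) ℕ.+ indicator (se w))       ≡⟨ sumOver-cong ps pointwise ⟩
  sumOver ps (λ w → indicator (ind w) ℕ.+ (indicator (s w) ℕ.+ indicator (e w)))
                                           ≡⟨ trans (sumOver-+ ps (indicator ∘ ind) _) (cong (sumOver ps (indicator ∘ ind) ℕ.+_) (sumOver-+ ps (indicator ∘ s) (indicator ∘ e))) ⟩
  sumOver ps (indicator ∘ ind) ℕ.+ (sumOver ps (indicator ∘ s) ℕ.+ sumOver ps (indicator ∘ e))
    ≡⟨ cong₂ ℕ._+_ (count-sum ind ps) (cong₂ ℕ._+_ (trans (sym (count-starts (suc n) (a∧ r) (a∧ r) drop-first)) (count-sum s ps))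
                                                   (trans (sym (count-ends (suc n) (a∧ r) (a∧ r) drop-last)) (count-sum e ps))) ⟨
  count ind ps ℕ.+ (A (suc n) ℕ.+ A (suc n)) ∎
  where
  open ≡-Reasoning
  N = 2 ℕ.+ n
  ps = perms N
  a∧ : (List ℕ → Bool) → List ℕ → Bool
  a∧ q w = avoidsᵇ w p2143 ∧ q w
  A : ℕ → ℕ
  A m = count (a∧ r) (perms m)
  ind s e se : List ℕ → Bool
  ind w = avoidsᵇ w p2143 ∧ (indecomposableᵇ w ∧ r w)
  s  w = startsᵇ w ∧ a∧ r w
  e  w = endsᵇ N w ∧ a∧ r w
  se w = endsᵇ N w ∧ s w
  drop-first : ∀ {m w} → IsPerm m w → a∧ r (cons 0 w) ≡ a∧ r w
  drop-first {w = w} p rewrite avoids-2143 (cons 0 w) | avoids-2143 w | has2143-cons-0 p | r-cons p = refl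
  drop-last : ∀ {m w} → IsPerm m w → a∧ r (w ++ [ suc m ]) ≡ a∧ r w
  drop-last {m} {w} p rewrite avoids-2143 (w ++ [ suc m ]) | avoids-2143 w
                            | has2143-snoc (entries≤suc p) | r-snoc p = refl
  starts-snoc : ∀ {m w} → IsPerm (suc m) w → startsᵇ (w ++ [ 2 ℕ.+ m ]) ≡ startsᵇ w
  starts-snoc {w = _ ∷ _} p = refl
  -- The last entry goes first: at least one entry is left, so the leading 1 survives to be deleted
  -- next.
  count-se : count se ps ≡ A n
  count-se = trans
    (count-ends (suc n) s s (λ {w} p → cong₂ _∧_ (starts-snoc {w = w} p) (drop-last {w = w} p)))
    (count-starts n (a∧ r) (a∧ r) drop-first)
  pointwise : ∀ {w} → w ∈ ps → indicator (a∧ r w) ℕ.+ indicator (se w) ≡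
                               indicator (ind w) ℕ.+ (indicator (s w) ℕ.+ indicator (e w))
  pointwise {w} w∈ with has2143 w in eq
  ... | true rewrite avoids-2143 w | eq | ∧-zeroʳ (startsᵇ w) | ∧-zeroʳ (endsᵇ N w) = refl
  ... | false rewrite avoids-2143 w | eq | indecomposable-2143 (to (∈-perms N) w∈) eq
    -- For an avoider this is inclusion-exclusion on truth values.
    with startsᵇ w | endsᵇ N w | r w
  ... | true  | true  | true  = refl
  ... | true  | true  | false = refl
  ... | true  | false | true  = refl
  ... | true  | false | false = refl
  ... | false | true  | true  = refl
  ... | false | true  | false = refl
  ... | false | false | true  = refl
  ... | false | false | false = refl

-- Recurrences and power series

A2143-rec : ∀ n i → A2143 (2 ℕ.+ n) i ℕ.+ A2143 n i ≡ I2143 (2 ℕ.+ n) i ℕ.+ (A2143 (suc n) i ℕ.+ A2143 (suc n) i)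
A2143-rec n i = count-indecomposable (λ w → des w ≡ᵇ i)
  (λ p → cong (_≡ᵇ i) (des-cons-0 p)) (λ p → cong (_≡ᵇ i) (des-snoc (entries≤suc p))) n

-- The constant test `true` forgets the descents, that is, sets q = 1.
I2143₁-rec : ∀ n → E (2 ℕ.+ n) ℕ.+ E n ≡ I2143₁ (2 ℕ.+ n) ℕ.+ (E (suc n) ℕ.+ E (suc n))
I2143₁-rec n = begin
  E (2 ℕ.+ n) ℕ.+ E n                                ≡⟨ cong₂ ℕ._+_ (A≡E (2 ℕ.+ n)) (A≡E n) ⟨
  A (2 ℕ.+ n) ℕ.+ A n                                ≡⟨ count-indecomposable (λ _ → true) (λ _ → refl) (λ _ → refl) n ⟩
  I (2 ℕ.+ n) ℕ.+ (A (suc n) ℕ.+ A (suc n))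
    ≡⟨ cong₂ ℕ._+_ (I≡I2143₁ (2 ℕ.+ n)) (cong₂ ℕ._+_ (A≡E (suc n)) (A≡E (suc n))) ⟩
  I2143₁ (2 ℕ.+ n) ℕ.+ (E (suc n) ℕ.+ E (suc n))     ∎
  where
  open ≡-Reasoning
  A I : ℕ → ℕ
  A m = count (λ w → avoidsᵇ w p2143 ∧ true) (perms m)
  I m = count (λ w → avoidsᵇ w p2143 ∧ (indecomposableᵇ w ∧ true)) (perms m)
  A≡E : ∀ m → A m ≡ E m
  A≡E m = trans (count-cong {xs = perms m} (λ {w} _ → ∧-identityʳ (avoidsᵇ w p2143))) (count-2143 m)
  I≡I2143₁ : ∀ m → I m ≡ I2143₁ m
  I≡I2143₁ m = count-cong {xs = perms m} (λ {w} _ → cong (avoidsᵇ w p2143 ∧_) (∧-identityʳ (indecomposableᵇ w)))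

-- Over ℕ the recurrence is kept free of subtraction; in ℤ it is solved for its leading term, to
-- serve as a rewrite rule.
solve-recurrence : ∀ {a₂ a₁ a₀ b} → a₂ ℕ.+ a₀ ≡ b ℕ.+ (a₁ ℕ.+ a₁) → + a₂ ≡ + b + (+ a₁ + (+ a₁ - + a₀))
solve-recurrence {a₂} {a₁} {a₀} {b} e = begin
  + a₂                                ≡⟨ add-subtract (+ a₂) (+ a₀) ⟩
  + a₂ + + a₀ - + a₀                  ≡⟨ cong (λ k → + k - + a₀) e ⟩
  + b + (+ a₁ + + a₁) - + a₀          ≡⟨ regroup (+ b) (+ a₁) (+ a₀) ⟩
  + b + (+ a₁ + (+ a₁ - + a₀))        ∎
  where
  open ≡-Reasoning
  add-subtract : ∀ x y → x ≡ x + y - y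
  add-subtract = solve-∀
  regroup : ∀ x y z → x + (y + y) - z ≡ x + (y + (y - z))
  regroup = solve-∀

I2143₁-formula : ∀ n → + I2143₁ (2 ℕ.+ n) ≡ (+ E (2 ℕ.+ n) - + 2 * + E (suc n)) + + E n
I2143₁-formula n rewrite solve-recurrence {E (2 ℕ.+ n)} {E (suc n)} {E n} {I2143₁ (2 ℕ.+ n)} (I2143₁-rec n) =
  rearrange (+ I2143₁ (2 ℕ.+ n)) (+ E (suc n)) (+ E n)
  where
  rearrange : ∀ x y z → x ≡ (x + (y + (y - z)) - + 2 * y) + z
  rearrange = solve-∀

Aser-A2143 : ∀ n i → Aser n i ≡ + A2143 n i
Aser-A2143 zero    zero    = refl
Aser-A2143 zero    (suc i) = refl
Aser-A2143 (suc n) i       = refl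

-- Telescoping: from degree 2 on, `Iser` is the second difference of `Aser`, so its partial sums are
-- first differences. Subtracting x cancels the degree 1 term, in accordance with equal coefficients
-- of `Aser` in degrees 0 and 1.
geom-I : ∀ n i → geom₂ (Iser ⊖₂ x₂) (suc n) i ≡ Aser (suc n) i - Aser n i
geom-I zero zero    = refl
geom-I zero (suc i) = refl
geom-I (suc n) i
  rewrite geom-I n i | Aser-A2143 n i
        | solve-recurrence {A2143 (2 ℕ.+ n) i} {A2143 (suc n) i} {A2143 n i} {I2143 (2 ℕ.+ n) i} (A2143-rec n i)
  = rearrange (+ I2143 (2 ℕ.+ n) i) (+ A2143 (suc n) i) (+ A2143 n i)
  where
  rearrange : ∀ x y z → y - z + (x - + 0) ≡ x + (y + (y - z)) - y
  rearrange = solve-∀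

-- By `geom-I` the coefficient of x^(n+2) on the right is I_(n+2) + A_(n+1) + (A_(n+1) - A_n), which
-- is the recurrence; the lower degrees compute.
A-functional-equation : ∀ n i → Aser n i
  ≡ (one₂ ⊕₂ Iser ⊕₂ xTimes₂ (Aser ⊖₂ one₂) ⊕₂ xTimes₂ (geom₂ (Iser ⊖₂ x₂))) n i
A-functional-equation zero zero          = refl
A-functional-equation zero (suc i)       = refl
A-functional-equation (suc zero) zero    = refl
A-functional-equation (suc zero) (suc i) = refl
A-functional-equation (suc (suc n)) i
  rewrite geom-I n i | Aser-A2143 n i
        | solve-recurrence {A2143 (2 ℕ.+ n) i} {A2143 (suc n) i} {A2143 n i} {I2143 (2 ℕ.+ n) i} (A2143-rec n i)
  = rearrange (+ I2143 (2 ℕ.+ n) i) (+ A2143 (suc n) i) (+ A2143 n i)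
  where
  rearrange : ∀ x y z → x + (y + (y - z)) ≡ ((+ 0 + x) + (y - + 0)) + (y - z)
  rearrange = solve-∀

-- Multiplying by (1 - x)^2 takes second differences; 2x - 1 corrects the coefficients 1 and -1 in
-- degrees 0 and 1 to 0 and 1.
I-closed-form : ∀ n → Iser₁ n ≡ (oneMinusX₁ (oneMinusX₁ Eser) ⊕₁ twoXMinusOne) n
I-closed-form zero          = refl
I-closed-form (suc zero)    = refl
I-closed-form (suc (suc n)) = trans (I2143₁-formula n) (rearrange (+ E (2 ℕ.+ n)) (+ E (suc n)) (+ E n))
  where
  rearrange : ∀ x y z → (x - + 2 * y) + z ≡ ((x - y) - (y - z)) + + 0
  rearrange = solve-∀

theorem3p13 : ((n i : ℕ) → Aser n i
    ≡ (one₂ ⊕₂ Iser ⊕₂ xTimes₂ (Aser ⊖₂ one₂) ⊕₂ xTimes₂ (geom₂ (Iser ⊖₂ x₂))) n i)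
    × ((n : ℕ) → Iser₁ n ≡ (oneMinusX₁ (oneMinusX₁ Eser) ⊕₁ twoXMinusOne) n)
    × (I2143₁ 1 ≡ 1)
    × ((n : ℕ) → n ≥ 2 →
    + I2143₁ n ≡ (+ E n - + 2 * + E (n ∸ 1)) + + E (n ∸ 2))
theorem3p13 =
  A-functional-equation , I-closed-form , refl , λ { (suc (suc n)) (s≤s (s≤s z≤n)) → I2143₁-formula n }
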